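{- Let $d,k\in\mathbb{N}$. For every $r\ge0$ there exists $C_{r,d,k}\in(0,\infty)$ such that for every $d$-admissible $n$, if $X$ is a $(d,k,n)$-random Steiner complex and $\sigma\in X^{d-1}$ (a fixed $d$-element subset of $[n]$), then \[ \mathbb{P}\big(X(\sigma,r)\cong T_{d,k}(r)\big)\ge1-\frac{C_{r,d,k}}{n}. \]
   Context: $d$-admissible: $n\ge d+1$ with $d-j\mid\binom{n-j-1}{d-j-1}$ for all $0\le j\le d-1$. $(n,d)$-Steiner system: family of $(d+1)$-subsets of $[n]$ containing every $d$-subset exactly once. $(d,k,n)$-random Steiner complex: the complex on $[n]$ consisting of all subsets of size $\le d$ together with $S_1\cup\dots\cup S_k$, with $S_j$ i.i.d. uniformly random $(n,d)$-Steiner systems. For a $d$-complex $X$, $G_d(X)$ is the graph on the $(d-1)$-faces with $\sigma\ne\sigma'$ adjacent iff $\sigma\cup\sigma'$ is a $d$-face. The $r$-neighbouring complex $X(\sigma_0,r)$ is the subcomplex $Y$ with $Y^{d-1}$ the ball of radius $r$ about $\sigma_0$ in $G_d(X)$, $Y^d$ the $d$-faces of $X$ all of whose $(d-1)$-faces lie in $Y^{d-1}$, and, for $\ell<d-1$, $Y^\ell$ the $\ell$-faces of $X$ contained in some element of $Y^{d-1}$. The arboreal complex $T_{d,k}$: start with one $d$-face, attach to each of its $(d-1)$-faces $k-1$ new $d$-faces each with a new vertex, and inductively attach $k-1$ new $d$-faces (each with a new vertex) to each newly created $(d-1)$-face; $T_{d,k}(r)$ denotes $T_{d,k}(\sigma,r)$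 for any $(d-1)$-face $\sigma$ (all isomorphic by transitivity). $\cong$ is simplicial isomorphism. -}

module Defs where

open import Data.Nat using (ℕ; zero; suc; _+_; _*_; _∸_; _≤_; _<_; _≡ᵇ_)
open import Data.Nat.Divisibility using (_∣_)
open import Data.Nat.Combinatorics using (_C_)
open import Data.Bool using (Bool; true; false; _∧_; _∨_; not)
open import Data.Fin using (Fin; zero; suc)
open import Data.Vec using (Vec; []; _∷_; tabulate; removeAt; toList; lookup)
open import Data.List using (List; []; _∷_; _++_; map; concatMap; length; filterᵇ)
open import Data.List.Membership.Propositional using (_∈_)
open import Data.List.Relation.Binary.Subset.Propositional using (_⊆_)
open import Data.List.Relation.Unary.Unique.Propositional using (Unique)
open import Data.Product using (Σ; _×_; _,_)
open import Data.Sum using (_⊎_)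
open import Data.Unit using (⊤)
open import Data.Empty using (⊥)
open import Relation.Nullary using (¬_)
open import Relation.Binary.PropositionalEquality using (_≡_)

Subset : ℕ → Set
Subset n = Vec Bool n

card : ∀ {n} → Subset n → ℕ
card [] = 0
card (true ∷ s) = suc (card s)
card (false ∷ s) = card s

_⊆ᵇ_ : ∀ {n} → Subset n → Subset n → Bool
[] ⊆ᵇ [] = true
(x ∷ s) ⊆ᵇ (y ∷ t) = (not x ∨ y) ∧ (s ⊆ᵇ t)

emptySub : ∀ n → Subset n
emptySub zero = []
emptySub (suc n) = false ∷ emptySub n

insertSub : ∀ {n} → Fin n → Subset n → Subset n
insertSub zero (_ ∷ s) = true ∷ s
insertSub (suc i) (x ∷ s) = x ∷ insertSub i s

toSub : ∀ {n} → List (Fin n) → Subset n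
toSub {n} [] = emptySub n
toSub (i ∷ l) = insertSub i (toSub l)

allSub : ∀ n → List (Subset n)
allSub zero = [] ∷ []
allSub (suc n) = map (false ∷_) (allSub n) ++ map (true ∷_) (allSub n)

-- Families of subsets of [n] (i.e. subsets of the power set), encoded
-- as complete binary trees of depth n; each family has a unique code.

Fam : ℕ → Set
Fam zero = Bool
Fam (suc n) = Fam n × Fam n

memF : ∀ {n} → Fam n → Subset n → Bool
memF {zero} b [] = b
memF {suc n} (F₀ , F₁) (false ∷ s) = memF F₀ s
memF {suc n} (F₀ , F₁) (true ∷ s) = memF F₁ s

allFam : ∀ n → List (Fam n)
allFam zero = true ∷ false ∷ []
allFam (suc n) = concatMap (λ a → map (a ,_) (allFam n)) (allFam n)

allB : ∀ {A : Set} → (A → Bool) → List A → Bool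
allB p [] = true
allB p (x ∷ l) = p x ∧ allB p l

countB : ∀ {A : Set} → (A → Bool) → List A → ℕ
countB p l = length (filterᵇ p l)

isSteiner : (n d : ℕ) → Fam n → Bool
isSteiner n d F =
  allB (λ s → not (memF F s) ∨ (card s ≡ᵇ suc d)) (allSub n)
  ∧ allB (λ τ → not (card τ ≡ᵇ d)
               ∨ (countB (λ s → memF F s ∧ (τ ⊆ᵇ s)) (allSub n) ≡ᵇ 1))
        (allSub n)

steinerSystems : (n d : ℕ) → List (Fam n)
steinerSystems n d = filterᵇ (isSteiner n d) (allFam n)

tuples : ∀ {A : Set} (k : ℕ) → List A → List (Vec A k)
tuples zero L = [] ∷ []
tuples (suc k) L = concatMap (λ a → map (a ∷_) (tuples k L)) L

-- sample space of the (d,k,n)-random Steiner complex: all k-tuples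
-- (S_1,…,S_k) of (n,d)-Steiner systems, each equally likely
Ω : (n d k : ℕ) → List (Vec (Fam n) k)
Ω n d k = tuples k (steinerSystems n d)

Admissible : (d n : ℕ) → Set
Admissible d n =
  (d + 1 ≤ n) × (∀ j → j < d → (d ∸ j) ∣ ((n ∸ j ∸ 1) C (d ∸ j ∸ 1)))

-- Abstract simplicial complexes: a vertex type and a predicate telling
-- which finite vertex sets (given as lists) are faces.

record Complex : Set₁ where
  field
    V    : Set
    Face : List V → Set
open Complex public

_≈ₛ_ : ∀ {A : Set} → List A → List A → Set
l ≈ₛ l' = (l ⊆ l') × (l' ⊆ l)

module Nb (K : Complex) (d : ℕ) where
  Facet : List (V K) → Set
  Facet l = Unique l × (length l ≡ d) × Face K l

  DFace : List (V K) → Set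
  DFace l = Unique l × (length l ≡ suc d) × Face K l

  Adj : List (V K) → List (V K) → Set
  Adj l l' = Facet l × Facet l' × ¬ (l ≈ₛ l')
             × Σ (List (V K)) (λ u → DFace u × (u ≈ₛ (l ++ l')))

  data Within (σ₀ : List (V K)) : ℕ → List (V K) → Set where
    here : ∀ {r τ} → Facet τ → τ ≈ₛ σ₀ → Within σ₀ r τ
    step : ∀ {r τ τ'} → Within σ₀ r τ → Adj τ τ' → Within σ₀ (suc r) τ'

  NFace : List (V K) → ℕ → List (V K) → Set
  NFace σ₀ r l = Unique l × Face K l ×
    ( ((length l < d) × Σ (List (V K)) (λ τ → Within σ₀ r τ × (l ⊆ τ)))
    ⊎ ((length l ≡ d) × Within σ₀ r l)
    ⊎ ((length l ≡ suc d) ×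
        (∀ τ → Unique τ → length τ ≡ d → τ ⊆ l → Within σ₀ r τ)) )

Nbhd : (K : Complex) (d : ℕ) → List (V K) → ℕ → Complex
Nbhd K d σ₀ r = record { V = V K ; Face = Nb.NFace K d σ₀ r }

_≅_ : Complex → Complex → Set
K ≅ L = Σ (V K → V L) λ f → Σ (V L → V K) λ g →
    (∀ x → Face K (x ∷ []) → Face L (f x ∷ []) × (g (f x) ≡ x))
  × (∀ y → Face L (y ∷ []) → Face K (g y ∷ []) × (f (g y) ≡ y))
  × (∀ l → Face K l → Face L (map f l))
  × (∀ l → Face L l → Face K (map g l))

XCx : (n d k : ℕ) → Vec (Fam n) k → Complex
XCx n d k t = record
  { V = Fin n
  ; Face = λ l → (card (toSub l) ≤ d)
                 ⊎ Σ (Fin k) (λ j → memF (lookup t j) (toSub l) ≡ true) }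

-- The arboreal complex T_{d,k} for dimension suc d.

module Arboreal (d k : ℕ) where
  data TFacet : Set where
    rootF : Fin (suc (suc d)) → TFacet
    -- newF τ j i : the facet of the j-th d-face attached to τ obtained
    -- by removing the i-th vertex of τ (keeping the new vertex)
    newF  : TFacet → Fin (k ∸ 1) → Fin (suc d) → TFacet

  data Vtx : Set where
    rootV : Fin (suc (suc d)) → Vtx
    newV  : TFacet → Fin (k ∸ 1) → Vtx

  data TDFace : Set where
    rootD  : TDFace
    childD : TFacet → Fin (k ∸ 1) → TDFace

  fverts : TFacet → Vec Vtx (suc d)
  fverts (rootF i) = removeAt (tabulate rootV) i
  fverts (newF τ j i) = newV τ j ∷ removeAt (fverts τ) i

  dverts : TDFace → Vec Vtx (suc (suc d))
  dverts rootD = tabulate rootV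
  dverts (childD τ j) = newV τ j ∷ fverts τ

  TCx : Complex
  TCx = record { V = Vtx ; Face = λ l → Σ TDFace (λ D → l ⊆ toList (dverts D)) }

  rootFacet : List Vtx
  rootFacet = toList (fverts (rootF zero))

-- T_{d,k} (only meaningful for d ≥ 1; a dummy for d = 0)
Tcx : (d k : ℕ) → Complex
Tcx zero k = record { V = ⊤ ; Face = λ _ → ⊥ }
Tcx (suc d) k = Arboreal.TCx d k

Troot : (d k : ℕ) → List (V (Tcx d k))
Troot zero k = []
Troot (suc d) k = Arboreal.rootFacet d k

Tr : (d k r : ℕ) → Complex
Tr d k r = Nbhd (Tcx d k) d (Troot d k) r

{-# OPTIONS --safe #-}
-- Explore X from σ: a word of (colour, position) pairs leads from σ through blocks of the prescribed colours
-- to a facet of X, which is evaluated by completing facets to blocks. If distinct tree vertices within distance r + 1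
-- never evaluate to the same vertex of [n], the evaluation restricts to an isomorphism between the two balls.
-- A shortest coincidence forces, for one of finitely many configurations (their number depending on d, k, r only), a
-- block of a system S_c made of a vertex s and already explored vertices, where no other explored vertex is s and
-- s itself was not found through S_c. Applying to S_c the transposition of s with any unexplored y keeps the
-- exploration but turns that block into one containing y, so y and the original tuple can be recovered:
-- n − O(1) switched tuples arise from each bad one, injectively, and the configuration has probability O(1/n).
module Submission where

open import Defs
open import Data.Nat as ℕ using (ℕ; zero; suc; _+_; _*_; _^_; _≤_; _<_; z≤n; s≤s; _≡ᵇ_)
open import Data.Nat.ListAction using (sum)
open import Data.Nat.Properties as ℕₚ using (≤-refl; ≤-trans)
open import Data.Bool as Bool using (Bool; true; false; _∧_; _∨_; not)
open import Data.Bool.Properties using (T-≡)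
open import Data.Fin using (Fin; zero; suc; punchIn; punchOut)
import Data.Fin.Properties as Finₚ
open import Data.Fin.Permutation.Components using (transpose; transpose-inverse)
open import Data.Vec as Vec using (Vec; []; _∷_; lookup; toList; removeAt; updateAt)
open import Data.Vec.Properties as Vecₚ using (lookup∘updateAt; lookup∘updateAt′; length-toList; toList-map)
open import Data.List as List using
  (List; []; _∷_; _++_; map; length; filter; allFin; concatMap; cartesianProductWith; cartesianProduct)
open import Data.List.Properties as Listₚ using (length-map; length-++; map-++; map-∘; map-id-local; map-cong-local)
open import Data.List.Membership.Propositional using (_∈_; _∉_; find; lose)
open import Data.List.Membership.Propositional.Properties
import Data.List.Membership.DecPropositional as DecMembership
open import Data.List.Relation.Binary.Subset.Propositional using (_⊆_)
import Data.List.Relation.Binary.Subset.Propositional.Properties as Subsetₚ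
open import Data.List.Relation.Unary.Any as Any using (Any; here; there; any?)
open import Data.List.Relation.Unary.All as All using (All; []; _∷_)
open import Data.List.Relation.Unary.AllPairs using ([]; _∷_)
open import Data.List.Relation.Unary.Unique.Propositional using (Unique)
import Data.List.Relation.Unary.Unique.Propositional.Properties as Uniqueₚ
open import Data.Product using (Σ; ∃; _×_; _,_; proj₁; proj₂)
open import Data.Product.Properties using (≡-dec)
open import Data.Sum using (_⊎_; inj₁; inj₂; [_,_]′)
open import Data.Unit using (⊤; tt)
open import Data.Empty using (⊥)
open import Function using (_∘_; id; _$_)
open import Function.Bundles using (Equivalence)
open import Relation.Nullary using (¬_; Dec; yes; no; contradiction; ¬?; _×-dec_)
open import Relation.Nullary.Decidable using (map′)
open import Relation.Binary.PropositionalEquality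

-- The delicate point is which vertex to switch. If φ(a) = φ(b), the block of colour c that
-- completed `a` contains the common image, but as the vertex of `b` that image may also have been
-- found through c, and a switch would then destroy its discovery. So the block is read differently:
-- the newest vertex z of the facet completed by `a` was found in another colour, and the block
-- consists of φ(z), φ(b) and d - 1 older vertices. This works unless z was met on the way to `b`.
-- Suppose it was, and likewise the newest vertex z' of the facet completed by `b` was met on the
-- way to `a`. Comparing depths leaves three cases. If z = b or z' = a, then `a` and `b` lie in one
-- block and have distinct images anyway. If z = z', the two facets belong to one block: for
-- different completing colours the common image can be switched after all, and for equal colours
-- two different blocks of one system would share d vertices.

private
  variable
    A B : Set
    n m : ℕ

-- Unique lists

∈-split-⊆ : ∀ {x : A} {xs ys zs} → x ∉ xs → xs ⊆ ys ++ x ∷ zs → xs ⊆ ys ++ zs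
∈-split-⊆ {ys = ys} x∉xs sub y∈xs with ∈-++⁻ ys (sub y∈xs)
... | inj₁ y∈ys = ∈-++⁺ˡ y∈ys
... | inj₂ (here refl) = contradiction y∈xs x∉xs
... | inj₂ (there y∈zs) = ∈-++⁺ʳ ys y∈zs

-- Pigeonhole in list form; the comparisons of sizes in the sample space rest on it.
unique-⊆-length : ∀ {xs ys : List A} → Unique xs → xs ⊆ ys → length xs ≤ length ys
unique-⊆-length {xs = []} u sub = z≤n
unique-⊆-length {xs = x ∷ xs} u@(_ ∷ uxs) sub with ∈-∃++ (sub (here refl))
... | ys , zs , refl
  rewrite length-++ ys {x ∷ zs} | ℕₚ.+-suc (length ys) (length zs) | sym (length-++ ys {zs})
  = s≤s (unique-⊆-length uxs (∈-split-⊆ (Uniqueₚ.Unique[x∷xs]⇒x∉xs u) (sub ∘ there)))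

unique-⊆-⊇ : ∀ {xs ys : List A} → (∀ x y → Dec (x ≡ y)) → Unique xs → xs ⊆ ys → length ys ≤ length xs → ys ⊆ xs
unique-⊆-⊇ {xs = xs} _≟_ u sub le {y} y∈ys with any? (y ≟_) xs
... | yes y∈xs = y∈xs
... | no y∉xs = contradiction
        (unique-⊆-length (All.tabulate (λ x∈xs y≡x → y∉xs (subst (_∈ xs) (sym y≡x) x∈xs)) ∷ u)
                         λ { (here refl) → y∈ys ; (there p) → sub p })
        (ℕₚ.<⇒≱ (s≤s le))

unique-map-injective : ∀ (f : A → B) {xs x y} → Unique (map f xs) → x ∈ xs → y ∈ xs → f x ≡ f y → x ≡ y
unique-map-injective f (_ ∷ _) (here refl) (here refl) _ = refl
unique-map-injective f (p ∷ _) (here refl) (there y∈) eq = contradiction eq (All.lookup p (∈-map⁺ f y∈))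
unique-map-injective f (p ∷ _) (there x∈) (here refl) eq = contradiction (sym eq) (All.lookup p (∈-map⁺ f x∈))
unique-map-injective f (_ ∷ u) (there x∈) (there y∈) eq = unique-map-injective f u x∈ y∈ eq

unique-map⁺ : ∀ (f : A → B) {xs} → (∀ {x y} → x ∈ xs → y ∈ xs → f x ≡ f y → x ≡ y) → Unique xs → Unique (map f xs)
unique-map⁺ f {[]} inj u = []
unique-map⁺ f {x ∷ xs} inj u@(_ ∷ uxs) =
  All.tabulate (λ y∈ fx≡y → let z , z∈ , y≡fz = ∈-map⁻ f y∈ in
    Uniqueₚ.Unique[x∷xs]⇒x∉xs u (subst (_∈ xs) (sym (inj (here refl) (there z∈) (trans fx≡y y≡fz))) z∈))
  ∷ unique-map⁺ f (λ p q → inj (there p) (there q)) uxs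

concatMap-map : ∀ {C : Set} (f : A → B → C) xs ys → concatMap (λ a → map (f a) ys) xs ≡ cartesianProductWith f xs ys
concatMap-map f [] ys = refl
concatMap-map f (x ∷ xs) ys = cong (map (f x) ys ++_) (concatMap-map f xs ys)

length-cartesianProductWith : ∀ {C : Set} (f : A → B → C) xs ys →
  length (cartesianProductWith f xs ys) ≡ length xs * length ys
length-cartesianProductWith f [] ys = refl
length-cartesianProductWith f (x ∷ xs) ys = trans (length-++ (map (f x) ys))
  (cong₂ _+_ (length-map (f x) ys) (length-cartesianProductWith f xs ys))

-- Removing an entry from a vector

removeAt-⊆ : ∀ (v : Vec A (suc m)) i → toList (removeAt v i) ⊆ toList v
removeAt-⊆ (x ∷ v) zero p = there p
removeAt-⊆ (x ∷ v@(_ ∷ _)) (suc i) (here p) = here p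
removeAt-⊆ (x ∷ v@(_ ∷ _)) (suc i) (there p) = there (removeAt-⊆ v i p)

removeAt-unique : ∀ (v : Vec A (suc m)) i → Unique (toList v) → Unique (toList (removeAt v i))
removeAt-unique (x ∷ v) zero (_ ∷ u) = u
removeAt-unique (x ∷ v@(_ ∷ _)) (suc i) (p ∷ u) =
  All.tabulate (λ q → All.lookup p (removeAt-⊆ v i q)) ∷ removeAt-unique v i u

lookup-∈ : ∀ (v : Vec A m) i → lookup v i ∈ toList v
lookup-∈ (x ∷ v) zero = here refl
lookup-∈ (x ∷ v) (suc i) = there (lookup-∈ v i)

∈-lookup⁻ : ∀ (v : Vec A m) {x} → x ∈ toList v → ∃ λ i → x ≡ lookup v i
∈-lookup⁻ (y ∷ v) (here p) = zero , p
∈-lookup⁻ (y ∷ v) (there p) = let i , q = ∈-lookup⁻ v p in suc i , q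

lookup-∉-removeAt : ∀ (v : Vec A (suc m)) i → Unique (toList v) → lookup v i ∉ toList (removeAt v i)
lookup-∉-removeAt (x ∷ v) zero u p = Uniqueₚ.Unique[x∷xs]⇒x∉xs u p
lookup-∉-removeAt (x ∷ v@(_ ∷ _)) (suc i) (p ∷ _) (here q) = All.lookup p (lookup-∈ v i) (sym q)
lookup-∉-removeAt (x ∷ v@(_ ∷ _)) (suc i) (_ ∷ u) (there q) = lookup-∉-removeAt v i u q

∈-removeAt⁺ : ∀ (v : Vec A (suc m)) i {x} → x ∈ toList v → x ≢ lookup v i → x ∈ toList (removeAt v i)
∈-removeAt⁺ (y ∷ v) zero (here p) x≢ = contradiction p x≢
∈-removeAt⁺ (y ∷ v) zero (there p) x≢ = p
∈-removeAt⁺ (y ∷ v@(_ ∷ _)) (suc i) (here p) x≢ = here p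
∈-removeAt⁺ (y ∷ v@(_ ∷ _)) (suc i) (there p) x≢ = there (∈-removeAt⁺ v i p x≢)

lookup-∈-removeAt : ∀ (v : Vec A (suc m)) {i j} → i ≢ j → lookup v j ∈ toList (removeAt v i)
lookup-∈-removeAt v {i} {j} i≢j =
  subst (_∈ toList (removeAt v i)) (Vecₚ.removeAt-punchOut v i≢j) (lookup-∈ (removeAt v i) (punchOut i≢j))

map-removeAt : ∀ (f : A → B) (v : Vec A (suc m)) i → Vec.map f (removeAt v i) ≡ removeAt (Vec.map f v) i
map-removeAt f (x ∷ v) zero = refl
map-removeAt f (x ∷ v@(_ ∷ _)) (suc i) = cong (f x ∷_) (map-removeAt f v i)

lookup-injective : ∀ (v : Vec A m) → Unique (toList v) → ∀ i j → lookup v i ≡ lookup v j → i ≡ j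
lookup-injective (x ∷ v) u zero zero eq = refl
lookup-injective (x ∷ v) (p ∷ _) zero (suc j) eq = contradiction eq (All.lookup p (lookup-∈ v j))
lookup-injective (x ∷ v) (p ∷ _) (suc i) zero eq = contradiction (sym eq) (All.lookup p (lookup-∈ v i))
lookup-injective (x ∷ v) (_ ∷ u) (suc i) (suc j) eq = cong suc (lookup-injective v u i j eq)

-- Remove entry `i`, then entry `j` at its shifted position `punchOut i≢j`. Used for two facets of
-- one block.
removeAt-∩ : ∀ (v : Vec A (suc m)) {i j} → i ≢ j → Unique (toList v) →
  ∃ λ l → Unique l × suc (length l) ≡ m × l ⊆ toList (removeAt v i) × l ⊆ toList (removeAt v j)
removeAt-∩ {m = zero} v {zero} {zero} i≢j u = contradiction refl i≢j
removeAt-∩ {m = suc m} v {i} {j} i≢j u =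
  toList (removeAt vᵢ j') , removeAt-unique vᵢ j' uᵢ , cong suc (length-toList (removeAt vᵢ j')) ,
  removeAt-⊆ vᵢ j' ,
  λ {x} x∈ → ∈-removeAt⁺ v j (removeAt-⊆ v i (removeAt-⊆ vᵢ j' x∈)) λ x≡ →
    lookup-∉-removeAt vᵢ j' uᵢ (subst (_∈ toList (removeAt vᵢ j')) (trans x≡ (sym (Vecₚ.removeAt-punchOut v i≢j))) x∈)
  where
  vᵢ = removeAt v i
  uᵢ = removeAt-unique v i u
  j' = punchOut i≢j

-- Balls in complexes

≈ₛ-sym : ∀ {l l' : List A} → l ≈ₛ l' → l' ≈ₛ l
≈ₛ-sym (p , q) = q , p

≈ₛ-trans : ∀ {l l' l'' : List A} → l ≈ₛ l' → l' ≈ₛ l'' → l ≈ₛ l''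
≈ₛ-trans (p , q) (p' , q') = p' ∘ p , q ∘ q'

≈ₛ-map : ∀ (f : A → B) {l l'} → l ≈ₛ l' → map f l ≈ₛ map f l'
≈ₛ-map f (p , q) = Subsetₚ.map⁺ f p , Subsetₚ.map⁺ f q

≈ₛ-++ : ∀ {l₁ l₁' l₂ l₂' : List A} → l₁ ≈ₛ l₁' → l₂ ≈ₛ l₂' → (l₁ ++ l₂) ≈ₛ (l₁' ++ l₂')
≈ₛ-++ (p , q) (p' , q') = Subsetₚ.++⁺ p p' , Subsetₚ.++⁺ q q'

-- Being one shorter, `l` misses some entry of `v`; it lies in what remains without that entry, and
-- equal lengths make the two equal as sets.
removeAt-of-⊆ : (∀ (x y : A) → Dec (x ≡ y)) → ∀ (v : Vec A (suc m)) → Unique (toList v) → ∀ {l} → Unique l → length l ≡ m →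
                l ⊆ toList v → ∃ λ i → l ≈ₛ toList (removeAt v i)
removeAt-of-⊆ {m = m} _≟_ v uv {l} u len l⊆ with Finₚ.any? (λ i → ¬? (any? (lookup v i ≟_) l))
... | yes (i , ∉l) = i , l⊆' , unique-⊆-⊇ _≟_ u l⊆' (ℕₚ.≤-reflexive (trans (length-toList (removeAt v i)) (sym len)))
  where
  l⊆' : l ⊆ toList (removeAt v i)
  l⊆' x∈ = ∈-removeAt⁺ v i (l⊆ x∈) λ x≡ → ∉l (subst (_∈ l) x≡ x∈)
... | no none = contradiction (unique-⊆-length uv v⊆l)
    (subst₂ (λ a b → ¬ (a ≤ b)) (sym (length-toList v)) (sym len) (ℕₚ.<⇒≱ ≤-refl))
  where
  v⊆l : toList v ⊆ l
  v⊆l x∈ with ∈-lookup⁻ v x∈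
  ... | i , refl with any? (lookup v i ≟_) l
  ... | yes p = p
  ... | no ∉l = contradiction (i , ∉l) none

module _ {K : Complex} {d : ℕ} {σ₀ : List (V K)} where
  open Nb K d hiding (here)

  within-resp : ∀ {r τ τ'} → Within σ₀ r τ → Facet τ' → τ ≈ₛ τ' → Within σ₀ r τ'
  within-resp (Nb.here _ e) f' e' = Nb.here f' (≈ₛ-trans (≈ₛ-sym e') e)
  within-resp (step w (f , _ , ≉ , u , du , e)) f' e' =
    step w (f , f' , (λ e'' → ≉ (≈ₛ-trans e'' (≈ₛ-sym e'))) , u , du , ≈ₛ-trans e (≈ₛ-++ (id , id) e'))

  within-suc : ∀ {r τ} → Within σ₀ r τ → Within σ₀ (suc r) τ
  within-suc (Nb.here f e) = Nb.here f e
  within-suc (step w a) = step (within-suc w) a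

  within-≤ : ∀ {r r' τ} → r ≤ r' → Within σ₀ r τ → Within σ₀ r' τ
  within-≤ le = go (ℕₚ.≤⇒≤′ le)
    where
    go : ∀ {r r' τ} → r ℕ.≤′ r' → Within σ₀ r τ → Within σ₀ r' τ
    go (ℕ.≤′-reflexive refl) w = w
    go (ℕ.≤′-step le) w = within-suc (go le w)

  within-facet : ∀ {r τ} → Within σ₀ r τ → Facet τ
  within-facet (Nb.here f _) = f
  within-facet (step _ (_ , f , _)) = f

facet-through : ∀ {l : List A} {x} → Unique l → length l ≡ suc (suc m) → x ∈ l →
                ∃ λ τ → Unique τ × length τ ≡ suc m × τ ⊆ l × x ∈ τ
facet-through {l = y ∷ z ∷ l} ((_ ∷ y∉) ∷ _ ∷ u) len (here refl) =
  y ∷ l , y∉ ∷ u , ℕₚ.suc-injective len , (λ { (here p) → here p ; (there p) → there (there p) }) , here refl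
facet-through {l = y ∷ l} (_ ∷ u) len (there x∈) = l , u , ℕₚ.suc-injective len , there , x∈

-- Reduces claims about vertices of a ball to claims about its facets. For a d-face this uses d ≥ 1,
-- so that each vertex survives in some facet.
nface-cover : ∀ {K d' σ₀ r l x} → Nb.NFace K (suc d') σ₀ r l → x ∈ l → ∃ λ τ → Nb.Within K (suc d') σ₀ r τ × x ∈ τ
nface-cover (_ , _ , inj₁ (_ , τ , w , l⊆τ)) x∈ = τ , w , l⊆τ x∈
nface-cover (_ , _ , inj₂ (inj₁ (_ , w))) x∈ = _ , w , x∈
nface-cover (u , _ , inj₂ (inj₂ (len , ws))) x∈ with facet-through u len x∈
... | τ , uτ , lenτ , τ⊆l , x∈τ = τ , ws τ uτ lenτ τ⊆l , x∈τ

-- Subsets of [n]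

≡true-ext : ∀ {a b} → (a ≡ true → b ≡ true) → (b ≡ true → a ≡ true) → a ≡ b
≡true-ext {false} {false} f g = refl
≡true-ext {false} {true} f g = g refl
≡true-ext {true} f g = sym (f refl)

∧-true⁻ : ∀ {a b} → a ∧ b ≡ true → a ≡ true × b ≡ true
∧-true⁻ {true} {true} _ = refl , refl

∧-true⁺ : ∀ {a b} → a ≡ true → b ≡ true → a ∧ b ≡ true
∧-true⁺ refl refl = refl

implies⁻ : ∀ {a b} → not a ∨ b ≡ true → a ≡ true → b ≡ true
implies⁻ {true} p _ = p

implies⁺ : ∀ {a b} → (a ≡ true → b ≡ true) → not a ∨ b ≡ true
implies⁺ {false} f = refl
implies⁺ {true} f = f refl

≡ᵇ-true⁻ : ∀ {a b} → (a ≡ᵇ b) ≡ true → a ≡ b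
≡ᵇ-true⁻ {a} {b} p = ℕₚ.≡ᵇ⇒≡ a b (Equivalence.from T-≡ p)

≡ᵇ-true⁺ : ∀ {a b} → a ≡ b → (a ≡ᵇ b) ≡ true
≡ᵇ-true⁺ {a} {b} p = Equivalence.to T-≡ (ℕₚ.≡⇒≡ᵇ a b p)

subset-ext : {s s' : Subset n} → (∀ i → lookup s i ≡ lookup s' i) → s ≡ s'
subset-ext {s = s} {s'} eq =
  trans (sym (Vecₚ.tabulate∘lookup s)) (trans (Vecₚ.tabulate-cong eq) (Vecₚ.tabulate∘lookup s'))

lookup-emptySub : ∀ n (i : Fin n) → lookup (emptySub n) i ≡ false
lookup-emptySub (suc n) zero = refl
lookup-emptySub (suc n) (suc i) = lookup-emptySub n i

lookup-insertSub : ∀ (i : Fin n) s → lookup (insertSub i s) i ≡ true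
lookup-insertSub zero (_ ∷ s) = refl
lookup-insertSub (suc i) (_ ∷ s) = lookup-insertSub i s

lookup-insertSub-≢ : ∀ {i j : Fin n} s → i ≢ j → lookup (insertSub i s) j ≡ lookup s j
lookup-insertSub-≢ {i = zero} {zero} (_ ∷ s) i≢j = contradiction refl i≢j
lookup-insertSub-≢ {i = zero} {suc j} (_ ∷ s) i≢j = refl
lookup-insertSub-≢ {i = suc i} {zero} (_ ∷ s) i≢j = refl
lookup-insertSub-≢ {i = suc i} {suc j} (_ ∷ s) i≢j = lookup-insertSub-≢ s (i≢j ∘ cong suc)

∈⇒toSub : ∀ {l} {x : Fin n} → x ∈ l → lookup (toSub l) x ≡ true
∈⇒toSub {l = y ∷ l} (here refl) = lookup-insertSub y (toSub l)
∈⇒toSub {l = y ∷ l} {x} (there x∈l) with y Finₚ.≟ x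
... | yes refl = lookup-insertSub y (toSub l)
... | no y≢x = trans (lookup-insertSub-≢ (toSub l) y≢x) (∈⇒toSub x∈l)

toSub⇒∈ : ∀ l {x : Fin n} → lookup (toSub l) x ≡ true → x ∈ l
toSub⇒∈ {n} [] {x} p with trans (sym (lookup-emptySub n x)) p
... | ()
toSub⇒∈ (y ∷ l) {x} p with y Finₚ.≟ x
... | yes refl = here refl
... | no y≢x = there (toSub⇒∈ l (trans (sym (lookup-insertSub-≢ (toSub l) y≢x)) p))

toSub-cong : ∀ {l l' : List (Fin n)} → l ≈ₛ l' → toSub l ≡ toSub l'
toSub-cong {l = l} {l'} (p , q) = subset-ext λ i → ≡true-ext (∈⇒toSub ∘ p ∘ toSub⇒∈ l) (∈⇒toSub ∘ q ∘ toSub⇒∈ l')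

toSub-injective : ∀ {l l' : List (Fin n)} → toSub l ≡ toSub l' → l ≈ₛ l'
toSub-injective {l = l} {l'} eq =
  (λ {x} x∈ → toSub⇒∈ l' (subst (λ s → lookup s x ≡ true) eq (∈⇒toSub x∈))) ,
  (λ {x} x∈ → toSub⇒∈ l (subst (λ s → lookup s x ≡ true) (sym eq) (∈⇒toSub x∈)))

card-insertSub : ∀ {i : Fin n} s → lookup s i ≡ false → card (insertSub i s) ≡ suc (card s)
card-insertSub {i = zero} (false ∷ s) p = refl
card-insertSub {i = suc i} (true ∷ s) p = cong suc (card-insertSub s p)
card-insertSub {i = suc i} (false ∷ s) p = card-insertSub s p

insertSub-idem : ∀ {i : Fin n} s → lookup s i ≡ true → insertSub i s ≡ s
insertSub-idem {i = zero} (true ∷ s) p = refl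
insertSub-idem {i = suc i} (x ∷ s) p = cong (x ∷_) (insertSub-idem s p)

card-emptySub : ∀ n → card (emptySub n) ≡ 0
card-emptySub zero = refl
card-emptySub (suc n) = card-emptySub n

card-toSub-≤ : ∀ (l : List (Fin n)) → card (toSub l) ≤ length l
card-toSub-≤ {n} [] = ℕₚ.≤-reflexive (card-emptySub n)
card-toSub-≤ (x ∷ l) with lookup (toSub l) x in eq
... | true rewrite insertSub-idem (toSub l) eq = ℕₚ.m≤n⇒m≤1+n (card-toSub-≤ l)
... | false rewrite card-insertSub (toSub l) eq = s≤s (card-toSub-≤ l)

card-toSub : ∀ {l : List (Fin n)} → Unique l → card (toSub l) ≡ length l
card-toSub {n} [] = card-emptySub n
card-toSub {l = x ∷ l} u@(_ ∷ ul) with lookup (toSub l) x in eq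
... | true = contradiction (toSub⇒∈ l eq) (Uniqueₚ.Unique[x∷xs]⇒x∉xs u)
... | false = trans (card-insertSub (toSub l) eq) (cong suc (card-toSub ul))

length≤card⇒unique : ∀ (l : List (Fin n)) → length l ≤ card (toSub l) → Unique l
length≤card⇒unique [] _ = []
length≤card⇒unique (x ∷ l) le with lookup (toSub l) x in eq
... | true rewrite insertSub-idem (toSub l) eq = contradiction (card-toSub-≤ l) (ℕₚ.<⇒≱ le)
... | false rewrite card-insertSub (toSub l) eq with le
... | s≤s le' = All.tabulate (λ { y∈l refl → case-⊥ (trans (sym eq) (∈⇒toSub y∈l)) }) ∷ length≤card⇒unique l le'
  where case-⊥ : false ≡ true → ⊥
        case-⊥ ()

⊆ᵇ⁻ : ∀ (s s' : Subset n) → s ⊆ᵇ s' ≡ true → ∀ i → lookup s i ≡ true → lookup s' i ≡ true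
⊆ᵇ⁻ (x ∷ s) (y ∷ s') p zero = implies⁻ {x} (proj₁ (∧-true⁻ p))
⊆ᵇ⁻ (x ∷ s) (y ∷ s') p (suc i) = ⊆ᵇ⁻ s s' (proj₂ (∧-true⁻ {not x ∨ y} p)) i

⊆ᵇ⁺ : ∀ (s s' : Subset n) → (∀ i → lookup s i ≡ true → lookup s' i ≡ true) → s ⊆ᵇ s' ≡ true
⊆ᵇ⁺ [] [] f = refl
⊆ᵇ⁺ (x ∷ s) (y ∷ s') f = ∧-true⁺ (implies⁺ {x} (f zero)) (⊆ᵇ⁺ s s' (f ∘ suc))

card-mono : ∀ (s s' : Subset n) → s ⊆ᵇ s' ≡ true → card s ≤ card s'
card-mono [] [] p = z≤n
card-mono (false ∷ s) (false ∷ s') p = card-mono s s' p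
card-mono (false ∷ s) (true ∷ s') p = ℕₚ.m≤n⇒m≤1+n (card-mono s s' p)
card-mono (true ∷ s) (true ∷ s') p = s≤s (card-mono s s' p)

⊆ᵇ-card-≡ : ∀ (s s' : Subset n) → s ⊆ᵇ s' ≡ true → card s' ≤ card s → s ≡ s'
⊆ᵇ-card-≡ [] [] p le = refl
⊆ᵇ-card-≡ (false ∷ s) (false ∷ s') p le = cong (false ∷_) (⊆ᵇ-card-≡ s s' p le)
⊆ᵇ-card-≡ (false ∷ s) (true ∷ s') p le = contradiction (card-mono s s' p) (ℕₚ.<⇒≱ le)
⊆ᵇ-card-≡ (true ∷ s) (true ∷ s') p (s≤s le) = cong (true ∷_) (⊆ᵇ-card-≡ s s' p le)

⊆ᵇ-card-suc : ∀ (s s' : Subset n) → s ⊆ᵇ s' ≡ true → card s' ≡ suc (card s) → ∃ λ v → s' ≡ insertSub v s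
⊆ᵇ-card-suc (false ∷ s) (true ∷ s') p eq =
  zero , cong (true ∷_) (sym (⊆ᵇ-card-≡ s s' p (ℕₚ.≤-reflexive (ℕₚ.suc-injective eq))))
⊆ᵇ-card-suc (false ∷ s) (false ∷ s') p eq = let v , q = ⊆ᵇ-card-suc s s' p eq in suc v , cong (false ∷_) q
⊆ᵇ-card-suc (true ∷ s) (true ∷ s') p eq =
  let v , q = ⊆ᵇ-card-suc s s' p (ℕₚ.suc-injective eq) in suc v , cong (true ∷_) q

-- A duplicate-free list turns `card` into `length`, which a transposition clearly preserves.
elements : ∀ (s : Subset n) → ∃ λ l → Unique l × s ≡ toSub l
elements {n} s = l , Uniqueₚ.filter⁺ P? (Uniqueₚ.allFin⁺ n) ,
    subset-ext λ i → ≡true-ext (λ p → ∈⇒toSub (∈-filter⁺ P? (∈-allFin i) p))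
                               (λ p → proj₂ (∈-filter⁻ P? {xs = allFin n} (toSub⇒∈ l p)))
  where
  P? = λ i → lookup s i Bool.≟ true
  l = filter P? (allFin n)

∈-allSub : ∀ (s : Subset n) → s ∈ allSub n
∈-allSub [] = here refl
∈-allSub (false ∷ s) = ∈-++⁺ˡ (∈-map⁺ (false ∷_) (∈-allSub s))
∈-allSub {suc n} (true ∷ s) = ∈-++⁺ʳ (map (false ∷_) (allSub n)) (∈-map⁺ (true ∷_) (∈-allSub s))

allSub-unique : ∀ n → Unique (allSub n)
allSub-unique zero = [] ∷ []
allSub-unique (suc n) =
  Uniqueₚ.++⁺ (Uniqueₚ.map⁺ Vecₚ.∷-injectiveʳ (allSub-unique n)) (Uniqueₚ.map⁺ Vecₚ.∷-injectiveʳ (allSub-unique n)) disjoint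
  where
  disjoint : ∀ {s} → ¬ (s ∈ map (false ∷_) (allSub n) × s ∈ map (true ∷_) (allSub n))
  disjoint (p , q) with ∈-map⁻ (false ∷_) p | ∈-map⁻ (true ∷_) q
  ... | _ , _ , refl | _ , _ , ()

-- The action of transpositions on subsets and families

transpose-sym : ∀ (x y z : Fin n) → transpose x y z ≡ transpose y x z
transpose-sym x y z with z Finₚ.≟ x in eqx | z Finₚ.≟ y in eqy
... | yes refl | yes refl = refl
... | yes p | no _ rewrite eqx = refl
... | no _ | yes p rewrite eqy = refl
... | no _ | no _ rewrite eqx | eqy = refl

transpose-involutive : ∀ (x y z : Fin n) → transpose x y (transpose x y z) ≡ z
transpose-involutive x y z rewrite transpose-sym x y z = transpose-inverse x y

transpose-left : ∀ (x y : Fin n) → transpose x y x ≡ y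
transpose-left x y with x Finₚ.≟ x
... | yes _ = refl
... | no x≢x = contradiction refl x≢x

transpose-fix : ∀ {x y z : Fin n} → z ≢ x → z ≢ y → transpose x y z ≡ z
transpose-fix {x = x} {y} {z} z≢x z≢y with z Finₚ.≟ x | z Finₚ.≟ y in eqy
... | yes p | _ = contradiction p z≢x
... | no _ | yes p = contradiction p z≢y
... | no _ | no _ rewrite eqy = refl

mkFam : (Subset n → Bool) → Fam n
mkFam {zero} p = p []
mkFam {suc n} p = mkFam (p ∘ (false ∷_)) , mkFam (p ∘ (true ∷_))

memF-mkFam : ∀ (p : Subset n → Bool) s → memF (mkFam p) s ≡ p s
memF-mkFam p [] = refl
memF-mkFam p (false ∷ s) = memF-mkFam (p ∘ (false ∷_)) s
memF-mkFam p (true ∷ s) = memF-mkFam (p ∘ (true ∷_)) s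

Fam-ext : {F G : Fam n} → (∀ s → memF F s ≡ memF G s) → F ≡ G
Fam-ext {zero} eq = eq []
Fam-ext {suc n} eq = cong₂ _,_ (Fam-ext (eq ∘ (false ∷_))) (Fam-ext (eq ∘ (true ∷_)))

∈-allFam : ∀ (F : Fam n) → F ∈ allFam n
∈-allFam {zero} true = here refl
∈-allFam {zero} false = there (here refl)
∈-allFam {suc n} (F₀ , F₁) = subst ((F₀ , F₁) ∈_) (sym (concatMap-map _,_ (allFam n) (allFam n)))
  (∈-cartesianProductWith⁺ _,_ (∈-allFam F₀) (∈-allFam F₁))

allFam-unique : ∀ n → Unique (allFam n)
allFam-unique zero = ((λ ()) ∷ []) ∷ [] ∷ []
allFam-unique (suc n) = subst Unique (sym (concatMap-map _,_ (allFam n) (allFam n))) $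
  Uniqueₚ.cartesianProductWith⁺ _,_ (λ { refl → refl , refl }) (allFam-unique n) (allFam-unique n)

∈-tuples⁺ : ∀ {L : List A} (t : Vec A m) → (∀ i → lookup t i ∈ L) → t ∈ tuples m L
∈-tuples⁺ [] _ = here refl
∈-tuples⁺ {m = suc m} {L} (x ∷ t) p = subst ((x ∷ t) ∈_) (sym (concatMap-map _∷_ L (tuples m L)))
  (∈-cartesianProductWith⁺ _∷_ (p zero) (∈-tuples⁺ t (p ∘ suc)))

∈-tuples⁻ : ∀ {L : List A} {t : Vec A m} → t ∈ tuples m L → ∀ i → lookup t i ∈ L
∈-tuples⁻ {m = suc m} {L} {t} t∈ i
  with ∈-cartesianProductWith⁻ _∷_ L (tuples m L) (subst (t ∈_) (concatMap-map _∷_ L (tuples m L)) t∈)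
∈-tuples⁻ t∈ zero | x , t' , x∈ , t'∈ , refl = x∈
∈-tuples⁻ t∈ (suc i) | x , t' , x∈ , t'∈ , refl = ∈-tuples⁻ t'∈ i

tuples-unique : ∀ m {L : List A} → Unique L → Unique (tuples m L)
tuples-unique zero u = [] ∷ []
tuples-unique (suc m) {L} u = subst Unique (sym (concatMap-map _∷_ L (tuples m L))) $
  Uniqueₚ.cartesianProductWith⁺ _∷_ Vecₚ.∷-injective u (tuples-unique m u)

swapSub : Fin n → Fin n → Subset n → Subset n
swapSub x y s = Vec.tabulate (lookup s ∘ transpose x y)

lookup-swapSub : ∀ (x y : Fin n) s i → lookup (swapSub x y s) i ≡ lookup s (transpose x y i)
lookup-swapSub x y s i = Vecₚ.lookup∘tabulate _ i

swapSub-involutive : ∀ (x y : Fin n) s → swapSub x y (swapSub x y s) ≡ s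
swapSub-involutive x y s = subset-ext λ i → trans (lookup-swapSub x y (swapSub x y s) i)
  (trans (lookup-swapSub x y s (transpose x y i)) (cong (lookup s) (transpose-involutive x y i)))

swapSub-toSub : ∀ (x y : Fin n) l → swapSub x y (toSub l) ≡ toSub (map (transpose x y) l)
swapSub-toSub x y l = subset-ext λ i → trans (lookup-swapSub x y (toSub l) i) $ ≡true-ext
  (λ p → ∈⇒toSub (subst (_∈ map (transpose x y) l) (transpose-involutive x y i)
           (∈-map⁺ (transpose x y) (toSub⇒∈ l p))))
  (λ p → let z , z∈ , i≡ = ∈-map⁻ (transpose x y) (toSub⇒∈ (map (transpose x y) l) p) in
    ∈⇒toSub (subst (_∈ l) (sym (trans (cong (transpose x y) i≡) (transpose-involutive x y z))) z∈))

card-swapSub : ∀ (x y : Fin n) s → card (swapSub x y s) ≡ card s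
card-swapSub x y s with elements s
... | l , u , refl = begin
  card (swapSub x y (toSub l))           ≡⟨ cong card (swapSub-toSub x y l) ⟩
  card (toSub (map (transpose x y) l))   ≡⟨ card-toSub (Uniqueₚ.map⁺ transpose-injective u) ⟩
  length (map (transpose x y) l)         ≡⟨ length-map _ l ⟩
  length l                               ≡⟨ card-toSub u ⟨
  card (toSub l)                         ∎
  where
  open ≡-Reasoning
  transpose-injective : ∀ {a b} → transpose x y a ≡ transpose x y b → a ≡ b
  transpose-injective {a} {b} eq =
    trans (sym (transpose-involutive x y a)) (trans (cong (transpose x y) eq) (transpose-involutive x y b))

swapSub-⊆ᵇ : ∀ (x y : Fin n) s s' → s ⊆ᵇ s' ≡ true → swapSub x y s ⊆ᵇ swapSub x y s' ≡ true
swapSub-⊆ᵇ x y s s' p = ⊆ᵇ⁺ (swapSub x y s) (swapSub x y s') λ i q →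
  trans (lookup-swapSub x y s' i) (⊆ᵇ⁻ s s' p (transpose x y i) (trans (sym (lookup-swapSub x y s i)) q))

-- A transposition is an involution, so this preimage family is also the image family.
swapFam : Fin n → Fin n → Fam n → Fam n
swapFam x y F = mkFam (memF F ∘ swapSub x y)

memF-swapFam : ∀ (x y : Fin n) F s → memF (swapFam x y F) s ≡ memF F (swapSub x y s)
memF-swapFam x y F = memF-mkFam _

swapFam-involutive : ∀ (x y : Fin n) F → swapFam x y (swapFam x y F) ≡ F
swapFam-involutive x y F = Fam-ext λ s →
  trans (memF-swapFam x y _ s) (trans (memF-swapFam x y F _) (cong (memF F) (swapSub-involutive x y s)))

-- Steiner systems

record Steiner (n d : ℕ) (F : Fam n) : Set where
  field
    block-card : ∀ {s} → memF F s ≡ true → card s ≡ suc d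
    cover : ∀ τ → card τ ≡ d → ∃ λ s → memF F s ≡ true × τ ⊆ᵇ s ≡ true
    cover-unique : ∀ τ {s s'} → card τ ≡ d → memF F s ≡ true → τ ⊆ᵇ s ≡ true →
                   memF F s' ≡ true → τ ⊆ᵇ s' ≡ true → s ≡ s'
open Steiner public

allB⁻ : ∀ (p : A → Bool) {l x} → allB p l ≡ true → x ∈ l → p x ≡ true
allB⁻ p h (here refl) = proj₁ (∧-true⁻ h)
allB⁻ p {l = y ∷ l} h (there x∈) = allB⁻ p (proj₂ (∧-true⁻ {p y} h)) x∈

allB⁺ : ∀ (p : A → Bool) l → (∀ x → p x ≡ true) → allB p l ≡ true
allB⁺ p [] h = refl
allB⁺ p (x ∷ l) h = ∧-true⁺ (h x) (allB⁺ p l h)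

length≡1⁻ : ∀ {l : List A} → length l ≡ 1 → (∃ λ x → x ∈ l) × (∀ {x y} → x ∈ l → y ∈ l → x ≡ y)
length≡1⁻ {l = x ∷ []} _ = (x , here refl) , λ { (here refl) (here refl) → refl }

length≡1⁺ : ∀ {l : List A} {x} → Unique l → x ∈ l → (∀ {y} → y ∈ l → y ≡ x) → length l ≡ 1
length≡1⁺ {l = y ∷ []} u _ h = refl
length≡1⁺ {l = y ∷ z ∷ l} ((y≢z ∷ _) ∷ _) _ h =
  contradiction (trans (h (here refl)) (sym (h (there (here refl))))) y≢z

module _ (p : Subset n → Bool) where
  private
    hits : List (Subset n)
    hits = List.filterᵇ p (allSub n)

  ∈-hits⁺ : ∀ {s} → p s ≡ true → s ∈ hits
  ∈-hits⁺ {s} ps = ∈-filter⁺ (Bool.T? ∘ p) (∈-allSub s) (Equivalence.from T-≡ ps)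

  ∈-hits⁻ : ∀ {s} → s ∈ hits → p s ≡ true
  ∈-hits⁻ s∈ = Equivalence.to T-≡ (proj₂ (∈-filter⁻ (Bool.T? ∘ p) {xs = allSub n} s∈))

  countB≡1⁻ : countB p (allSub n) ≡ 1 → (∃ λ s → p s ≡ true) × (∀ {s s'} → p s ≡ true → p s' ≡ true → s ≡ s')
  countB≡1⁻ eq = let (s , s∈) , all≡ = length≡1⁻ eq in
    (s , ∈-hits⁻ s∈) , λ ps ps' → all≡ (∈-hits⁺ ps) (∈-hits⁺ ps')

  countB≡1⁺ : ∀ {s} → p s ≡ true → (∀ {s'} → p s' ≡ true → s' ≡ s) → countB p (allSub n) ≡ 1
  countB≡1⁺ ps h = length≡1⁺ (Uniqueₚ.filter⁺ (Bool.T? ∘ p) (allSub-unique n)) (∈-hits⁺ ps) (h ∘ ∈-hits⁻)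

module _ {n d : ℕ} {F : Fam n} where

  isSteiner⁻ : isSteiner n d F ≡ true → Steiner n d F
  isSteiner⁻ h = record
    { block-card = λ {s} ms → ≡ᵇ-true⁻ (implies⁻ (allB⁻ _ (proj₁ h') (∈-allSub s)) ms)
    ; cover = λ τ cτ → let s , ps = proj₁ (one τ cτ) in s , ∧-true⁻ ps
    ; cover-unique = λ τ cτ ms s⊇ ms' s'⊇ → proj₂ (one τ cτ) (∧-true⁺ ms s⊇) (∧-true⁺ ms' s'⊇)
    }
    where
    h' = ∧-true⁻ h
    one : ∀ τ → card τ ≡ d → _
    one τ cτ = countB≡1⁻ (λ s → memF F s ∧ (τ ⊆ᵇ s))
      (≡ᵇ-true⁻ (implies⁻ (allB⁻ _ (proj₂ h') (∈-allSub τ)) (≡ᵇ-true⁺ cτ)))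

  isSteiner⁺ : Steiner n d F → isSteiner n d F ≡ true
  isSteiner⁺ S = ∧-true⁺
    (allB⁺ _ (allSub n) λ s → implies⁺ (λ ms → ≡ᵇ-true⁺ (block-card S ms)))
    (allB⁺ _ (allSub n) λ τ → implies⁺ λ cτ →
      let s , ms , s⊇ = cover S τ (≡ᵇ-true⁻ cτ) in
      ≡ᵇ-true⁺ (countB≡1⁺ (λ s → memF F s ∧ (τ ⊆ᵇ s)) (∧-true⁺ ms s⊇)
        λ {s'} ps' → let ms' , s'⊇ = ∧-true⁻ ps' in cover-unique S τ (≡ᵇ-true⁻ cτ) ms' s'⊇ ms s⊇))

  ∈-steinerSystems⁻ : F ∈ steinerSystems n d → Steiner n d F
  ∈-steinerSystems⁻ F∈ = isSteiner⁻ (Equivalence.to T-≡ (proj₂ (∈-filter⁻ (Bool.T? ∘ isSteiner n d) {xs = allFam n} F∈)))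

  ∈-steinerSystems⁺ : Steiner n d F → F ∈ steinerSystems n d
  ∈-steinerSystems⁺ S = ∈-filter⁺ (Bool.T? ∘ isSteiner n d) (∈-allFam F) (Equivalence.from T-≡ (isSteiner⁺ S))

Ω-unique : ∀ n d k → Unique (Ω n d k)
Ω-unique n d k = tuples-unique k (Uniqueₚ.filter⁺ (Bool.T? ∘ isSteiner n d) (allFam-unique n))

-- The notion is invariant under relabelling of [n]; this is what keeps switched tuples in the
-- sample space.
swapFam-Steiner : ∀ {d} (x y : Fin n) {F} → Steiner n d F → Steiner n d (swapFam x y F)
swapFam-Steiner x y {F} S = record
  { block-card = λ {s} ms → trans (sym (card-swapSub x y s)) (block-card S (mem⁻ ms))
  ; cover = λ τ cτ → let s , ms , s⊇ = cover S (swapSub x y τ) (trans (card-swapSub x y τ) cτ) in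
      swapSub x y s , mem⁺ ms ,
      subst (λ τ' → τ' ⊆ᵇ swapSub x y s ≡ true) (swapSub-involutive x y τ) (swapSub-⊆ᵇ x y (swapSub x y τ) s s⊇)
  ; cover-unique = λ τ {s} {s'} cτ ms s⊇ ms' s'⊇ →
      trans (sym (swapSub-involutive x y s)) (trans (cong (swapSub x y)
        (cover-unique S (swapSub x y τ) (trans (card-swapSub x y τ) cτ)
          (mem⁻ ms) (swapSub-⊆ᵇ x y τ s s⊇) (mem⁻ ms') (swapSub-⊆ᵇ x y τ s' s'⊇)))
        (swapSub-involutive x y s'))
  }
  where
  mem⁻ : ∀ {s} → memF (swapFam x y F) s ≡ true → memF F (swapSub x y s) ≡ true
  mem⁻ {s} p = trans (sym (memF-swapFam x y F s)) p
  mem⁺ : ∀ {s} → memF F s ≡ true → memF (swapFam x y F) (swapSub x y s) ≡ true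
  mem⁺ {s} p = trans (memF-swapFam x y F _) (trans (cong (memF F) (swapSub-involutive x y s)) p)

swapFam-block : ∀ (x y : Fin n) F l → memF F (toSub l) ≡ true → memF (swapFam x y F) (toSub (map (transpose x y) l)) ≡ true
swapFam-block x y F l p = trans (memF-swapFam x y F _)
  (trans (cong (memF F) (trans (cong (swapSub x y) (sym (swapSub-toSub x y l))) (swapSub-involutive x y _))) p)

module _ {n d : ℕ} {F : Fam n} (S : Steiner n d F) where

  -- A block has exactly d + 1 elements, so d + 1 entries naming it cannot repeat. Hence a
  -- completing vertex is always new to its facet.
  block-unique : ∀ {l} → length l ≡ suc d → memF F (toSub l) ≡ true → Unique l
  block-unique {l} len p = length≤card⇒unique l (ℕₚ.≤-reflexive (trans len (sym (block-card S p))))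

  block-determined : ∀ {l u u' : List (Fin n)} → Unique l → length l ≡ d → memF F (toSub u) ≡ true → l ⊆ u →
                     memF F (toSub u') ≡ true → l ⊆ u' → u ≈ₛ u'
  block-determined {l} {u} {u'} ul len mu l⊆u mu' l⊆u' = toSub-injective
    (cover-unique S (toSub l) (trans (card-toSub ul) len)
      mu (⊆ᵇ⁺ (toSub l) (toSub u) λ i → ∈⇒toSub ∘ l⊆u ∘ toSub⇒∈ l)
      mu' (⊆ᵇ⁺ (toSub l) (toSub u') λ i → ∈⇒toSub ∘ l⊆u' ∘ toSub⇒∈ l))

  block-extension : ∀ {l} → Unique l → length l ≡ d → ∃ λ v → memF F (toSub (v ∷ l)) ≡ true
  block-extension {l} ul len =
    let cl = trans (card-toSub ul) len
        s , ms , s⊇ = cover S (toSub l) cl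
        v , s≡ = ⊆ᵇ-card-suc (toSub l) s s⊇ (trans (block-card S ms) (cong suc (sym cl)))
    in v , subst (λ s → memF F s ≡ true) s≡ ms

-- The vertex completing a d-set to a block; v₀ is a junk value, returned only when there is none.

opaque
  completion : (v₀ : Fin n) → Fam n → List (Fin n) → Fin n
  completion v₀ F l with Finₚ.any? (λ v → memF F (toSub (v ∷ l)) Bool.≟ true)
  ... | yes (v , _) = v
  ... | no _ = v₀

module _ {n d : ℕ} (v₀ : Fin n) {F : Fam n} (S : Steiner n d F) where

  opaque
    unfolding completion

    completion-block : ∀ {l} → Unique l → length l ≡ d → memF F (toSub (completion v₀ F l ∷ l)) ≡ true
    completion-block {l} ul len with Finₚ.any? (λ v → memF F (toSub (v ∷ l)) Bool.≟ true)
    ... | yes (v , p) = p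
    ... | no ¬p = contradiction (block-extension S ul len) ¬p

  -- Distinctness of the entries of `l` is drawn from the block itself. The lemma thus applies to
  -- images under an evaluation not yet known to be injective.
  completion-≡ : ∀ {l v} → length l ≡ d → memF F (toSub (v ∷ l)) ≡ true → completion v₀ F l ≡ v
  completion-≡ {l} {v} len p with block-unique S (cong suc len) p
  ... | u@(_ ∷ ul) with proj₁ (block-determined S ul len (completion-block ul len) there p there) (here refl)
  ... | here eq = eq
  ... | there c∈l = contradiction c∈l (Uniqueₚ.Unique[x∷xs]⇒x∉xs (block-unique S (cong suc len) (completion-block ul len)))

-- Addresses of vertices and facets in the exploration of a complex

module Exploration (d' k' : ℕ) where

  d k : ℕ
  d = suc d'
  k = suc k'

  -- A word lists, last step first, the steps leading from σ to a facet: (c , i) passes from a facet to the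
  -- block of colour c containing it, and then to the facet of that block omitting the i-th old vertex.
  Word : Set
  Word = List (Fin k × Fin d)

  data Addr : Set where
    base : Fin d → Addr
    new : Word → Fin k → Addr

  _≟ᵃ_ : ∀ (a b : Addr) → Dec (a ≡ b)
  base i ≟ᵃ base j = map′ (cong base) (λ { refl → refl }) (i Finₚ.≟ j)
  base i ≟ᵃ new w c = no λ ()
  new w c ≟ᵃ base i = no λ ()
  new w c ≟ᵃ new w' c' = map′ (λ { (refl , refl) → refl }) (λ { refl → refl , refl })
    (Listₚ.≡-dec (≡-dec Finₚ._≟_ Finₚ._≟_) w w' ×-dec (c Finₚ.≟ c'))

  open DecMembership _≟ᵃ_ public using () renaming (_∈?_ to _∈?ᵃ_)

  depth : Addr → ℕ
  depth (base _) = 0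
  depth (new w _) = suc (length w)

  verts : Word → Vec Addr d
  verts [] = Vec.tabulate base
  verts ((c , i) ∷ w) = new w c ∷ removeAt (verts w) i

  -- Unlike `verts`, this keeps the vertices dropped on the way: a switch leaves a walk alone only
  -- if it avoids the blocks of all its steps.
  supp : Word → List Addr
  supp [] = toList (Vec.tabulate base)
  supp ((c , _) ∷ w) = new w c ∷ supp w

  -- The position zero is arbitrary: only the support and the validity of this word matter.
  wordOf : Addr → Word
  wordOf (base _) = []
  wordOf (new w c) = (c , zero) ∷ w

  -- Going on in the colour of the last step would complete the facet to the block just left and
  -- return the dropped vertex. Valid words are the walks without such backtracking.
  CompatibleHead : Fin k → Word → Set
  CompatibleHead c [] = ⊤
  CompatibleHead c ((c₀ , _) ∷ _) = c ≢ c₀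

  Valid : Word → Set
  Valid [] = ⊤
  Valid ((c , _) ∷ w) = CompatibleHead c w × Valid w

  ValidAddr : Addr → Set
  ValidAddr a = Valid (wordOf a)

  length-wordOf : ∀ a → length (wordOf a) ≡ depth a
  length-wordOf (base _) = refl
  length-wordOf (new _ _) = refl

  ∈-supp-base⁻ : ∀ {x} → x ∈ supp [] → ∃ λ i → x ≡ base i
  ∈-supp-base⁻ x∈ = let i , eq = ∈-lookup⁻ (Vec.tabulate base) x∈ in i , trans eq (Vecₚ.lookup∘tabulate base i)

  ∈-supp-base⁺ : ∀ i → base i ∈ supp []
  ∈-supp-base⁺ i = subst (_∈ supp []) (Vecₚ.lookup∘tabulate base i) (lookup-∈ (Vec.tabulate base) i)

  verts⊆supp : ∀ w → toList (verts w) ⊆ supp w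
  verts⊆supp [] p = p
  verts⊆supp ((c , i) ∷ w) (here p) = here p
  verts⊆supp ((c , i) ∷ w) (there p) = there (verts⊆supp w (removeAt-⊆ (verts w) i p))

  ∈-supp-wordOf : ∀ a → a ∈ supp (wordOf a)
  ∈-supp-wordOf (base i) = ∈-supp-base⁺ i
  ∈-supp-wordOf (new w c) = here refl

  supp-depth : ∀ w {x} → x ∈ supp w → depth x ≤ length w
  supp-depth [] x∈ with ∈-supp-base⁻ x∈
  ... | _ , refl = z≤n
  supp-depth (_ ∷ w) (here refl) = ≤-refl
  supp-depth (_ ∷ w) (there x∈) = ℕₚ.m≤n⇒m≤1+n (supp-depth w x∈)

  supp-valid : ∀ w {x} → Valid w → x ∈ supp w → ValidAddr x
  supp-valid [] _ x∈ with ∈-supp-base⁻ x∈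
  ... | _ , refl = tt
  supp-valid (_ ∷ w) p (here refl) = p
  supp-valid (_ ∷ w) (_ , p) (there x∈) = supp-valid w p x∈

  -- In (c , c₁ , v , q , ρ) the vertex new v c₁ is to form a block of colour c ≢ c₁ together with ρ, whose entries
  -- lie in the supports of v and q.
  Config : Set
  Config = Fin k × Fin k × Word × Word × Vec Addr d

  words : ℕ → List Word
  words zero = [] ∷ []
  words (suc R) = [] ∷ cartesianProductWith _∷_ (cartesianProduct (allFin k) (allFin d)) (words R)

  ∈-words : ∀ R {w} → length w ≤ R → w ∈ words R
  ∈-words zero {[]} _ = here refl
  ∈-words (suc R) {[]} _ = here refl
  ∈-words (suc R) {(c , i) ∷ w} (s≤s le) =
    there (∈-cartesianProductWith⁺ _∷_ (∈-cartesianProduct⁺ (∈-allFin c) (∈-allFin i)) (∈-words R le))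

  addrs : ℕ → List Addr
  addrs R = map base (allFin d) ++ cartesianProductWith new (words R) (allFin k)

  ∈-addrs : ∀ R {a} → depth a ≤ R → a ∈ addrs R
  ∈-addrs R {base i} _ = ∈-++⁺ˡ (∈-map⁺ base (∈-allFin i))
  ∈-addrs R {new w c} le = ∈-++⁺ʳ (map base (allFin d))
    (∈-cartesianProductWith⁺ new (∈-words R (≤-trans (ℕₚ.n≤1+n _) le)) (∈-allFin c))

  -- The enumeration involves `d`, `k` and `R` only, never n, so a sum over it may serve as the
  -- constant of the theorem.
  configs : ℕ → List Config
  configs R = cartesianProduct (allFin k) $ cartesianProduct (allFin k) $
    cartesianProduct (words R) $ cartesianProduct (words R) $ tuples d (addrs R)

  ∈-configs : ∀ R {c c₁ v q ρ} → length v ≤ R → length q ≤ R → (∀ {x} → x ∈ toList ρ → depth x ≤ R) →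
              (c , c₁ , v , q , ρ) ∈ configs R
  ∈-configs R {c} {c₁} {ρ = ρ} v≤ q≤ ρ≤ =
    ∈-cartesianProduct⁺ (∈-allFin c) $ ∈-cartesianProduct⁺ (∈-allFin c₁) $
    ∈-cartesianProduct⁺ (∈-words R v≤) $ ∈-cartesianProduct⁺ (∈-words R q≤) $
    ∈-tuples⁺ ρ λ i → ∈-addrs R (ρ≤ (lookup-∈ ρ i))

  seen : Config → List Addr
  seen (_ , _ , v , q , _) = supp v ++ supp q

  -- Bounds n times the probability of the event: 1 for the switches with unseen y, and 1 for each
  -- seen address that y may hit.
  weight : Config → ℕ
  weight cf = suc (length (seen cf))

  -- The arboreal complex

  open Arboreal d' k

  -- The tree carries no colours. A facet inherits the colour of the d-face that created it, and
  -- `punchIn` gives its k - 1 further d-faces the remaining colours.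
  colourF : TFacet → Fin k
  colourF (rootF _) = zero
  colourF (newF τ j _) = punchIn (colourF τ) j

  colourD : TDFace → Fin k
  colourD rootD = zero
  colourD (childD τ j) = punchIn (colourF τ) j

  -- The root d-face has colour zero and σ is its facet rootF zero, so rootV zero is the vertex attached to σ in
  -- colour zero.
  embF : TFacet → Word
  embF (rootF zero) = []
  embF (rootF (suc i)) = (zero , i) ∷ []
  embF (newF τ j i) = (punchIn (colourF τ) j , i) ∷ embF τ

  embV : Vtx → Addr
  embV (rootV zero) = new [] zero
  embV (rootV (suc i)) = base i
  embV (newV τ j) = new (embF τ) (punchIn (colourF τ) j)

  -- Root facets and later ones could only collide at length one, and there `punchIn zero` avoids
  -- the colour zero of the root face.
  embF-injective : ∀ τ τ' → embF τ ≡ embF τ' → τ ≡ τ'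
  embF-injective (rootF zero) (rootF zero) eq = refl
  embF-injective (rootF (suc i)) (rootF (suc .i)) refl = refl
  embF-injective (rootF (suc i)) (newF (rootF zero) j i') ()
  embF-injective (newF τ j i') (rootF zero) ()
  embF-injective (newF (rootF zero) j i') (rootF (suc i)) ()
  embF-injective (newF (rootF (suc _)) j i') (rootF (suc i)) ()
  embF-injective (newF (newF _ _ _) j i') (rootF (suc i)) ()
  embF-injective (newF τ j i) (newF τ' j' i') eq with Listₚ.∷-injective eq
  ... | p , q with embF-injective τ τ' q
  ... | refl with Finₚ.punchIn-injective (colourF τ) j j' (cong proj₁ p) | cong proj₂ p
  ... | refl | refl = refl

  embV-injective : ∀ u v → embV u ≡ embV v → u ≡ v
  embV-injective (rootV zero) (rootV zero) eq = refl
  embV-injective (rootV zero) (newV (rootF zero) j) ()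
  embV-injective (newV (rootF zero) j) (rootV zero) ()
  embV-injective (newV (rootF (suc _)) j) (rootV zero) ()
  embV-injective (newV (newF _ _ _) j) (rootV zero) ()
  embV-injective (newV τ j) (rootV (suc i)) ()
  embV-injective (rootV (suc i)) (rootV (suc .i)) refl = refl
  embV-injective (newV τ j) (newV τ' j') eq with embF-injective τ τ' (new-injectiveˡ eq)
    where
    new-injectiveˡ : ∀ {w w' c c'} → new w c ≡ new w' c' → w ≡ w'
    new-injectiveˡ refl = refl
  ... | refl = cong (newV τ) (Finₚ.punchIn-injective (colourF τ) j j' (new-injectiveʳ eq))
    where
    new-injectiveʳ : ∀ {w w' c c'} → new w c ≡ new w' c' → c ≡ c'
    new-injectiveʳ refl = refl

  _≟ᵛ_ : ∀ (u v : Vtx) → Dec (u ≡ v)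
  u ≟ᵛ v = map′ (embV-injective u v) (cong embV) (embV u ≟ᵃ embV v)

  embF-valid : ∀ τ → Valid (embF τ)
  embF-compatible : ∀ τ j → CompatibleHead (punchIn (colourF τ) j) (embF τ)
  embF-compatible (rootF zero) j = tt
  embF-compatible (rootF (suc i)) j = Finₚ.punchInᵢ≢i zero j
  embF-compatible (newF τ j' i) j = Finₚ.punchInᵢ≢i (punchIn (colourF τ) j') j
  embF-valid (rootF zero) = tt
  embF-valid (rootF (suc i)) = tt , tt
  embF-valid (newF τ j i) = embF-compatible τ j , embF-valid τ

  embV-valid : ∀ v → ValidAddr (embV v)
  embV-valid (rootV zero) = tt , tt
  embV-valid (rootV (suc i)) = tt
  embV-valid (newV τ j) = embF-compatible τ j , embF-valid τ

  -- An equality of vectors, not just of sets, because the positions in a word index their entries.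
  verts-embF : ∀ τ → verts (embF τ) ≡ Vec.map embV (fverts τ)
  verts-embF (rootF zero) = Vecₚ.tabulate-∘ embV (rootV ∘ suc)
  verts-embF (rootF (suc i)) = cong (new [] zero ∷_)
    (trans (cong (λ v → removeAt v i) (Vecₚ.tabulate-∘ embV (rootV ∘ suc)))
      (sym (map-removeAt embV (Vec.tabulate (rootV ∘ suc)) i)))
  verts-embF (newF τ j i) = cong (new (embF τ) (punchIn (colourF τ) j) ∷_)
    (trans (cong (λ v → removeAt v i) (verts-embF τ)) (sym (map-removeAt embV (fverts τ) i)))

  depthF : TFacet → ℕ
  depthF τ = length (embF τ)

  depthV : Vtx → ℕ
  depthV v = depth (embV v)

  depthD : TDFace → ℕ
  depthD rootD = 1
  depthD (childD τ j) = suc (depthF τ)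

  facetOf : TDFace → Fin (suc d) → TFacet
  facetOf rootD i = rootF i
  facetOf (childD τ j) zero = τ
  facetOf (childD τ j) (suc i) = newF τ j i

  fverts-facetOf : ∀ D i → fverts (facetOf D i) ≡ removeAt (dverts D) i
  fverts-facetOf rootD i = refl
  fverts-facetOf (childD τ j) zero = refl
  fverts-facetOf (childD τ j) (suc i) with fverts τ
  ... | _ ∷ _ = refl

  depthF-facetOf : ∀ D i → depthF (facetOf D i) ≤ depthD D
  depthF-facetOf rootD zero = z≤n
  depthF-facetOf rootD (suc i) = ≤-refl
  depthF-facetOf (childD τ j) zero = ℕₚ.n≤1+n _
  depthF-facetOf (childD τ j) (suc i) = ≤-refl

  parentD : TFacet → TDFace
  parentD (rootF _) = rootD
  parentD (newF τ j _) = childD τ j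

  parentD-colour : ∀ τ → colourD (parentD τ) ≡ colourF τ
  parentD-colour (rootF _) = refl
  parentD-colour (newF τ j _) = refl

  facetOf-parentD : ∀ τ → ∃ λ i → τ ≡ facetOf (parentD τ) i
  facetOf-parentD (rootF i) = i , refl
  facetOf-parentD (newF τ j i) = suc i , refl

  depthD-parentD : ∀ τ → depthD (parentD τ) ≤ suc (depthF τ)
  depthD-parentD (rootF _) = s≤s z≤n
  depthD-parentD (newF τ j i) = ℕₚ.n≤1+n _

  -- The tree counterpart of covering a d-set in every system: the parent serves its own colour, a
  -- child each other colour.
  faceAt : ∀ τ c → ∃ λ D → ∃ λ i → τ ≡ facetOf D i × colourD D ≡ c × depthD D ≤ suc (depthF τ)
  faceAt τ c with colourF τ Finₚ.≟ c
  ... | yes eq = let i , τ≡ = facetOf-parentD τ in parentD τ , i , τ≡ , trans (parentD-colour τ) eq , depthD-parentD τ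
  ... | no ≢c = childD τ (punchOut ≢c) , zero , refl , Finₚ.punchIn-punchOut ≢c , ≤-refl

  depthV≤depthF : ∀ τ {v} → v ∈ toList (fverts τ) → depthV v ≤ depthF τ
  depthV≤depthF τ {v} v∈ = supp-depth (embF τ) (verts⊆supp (embF τ)
    (subst (embV v ∈_) (sym (trans (cong toList (verts-embF τ)) (toList-map embV (fverts τ)))) (∈-map⁺ embV v∈)))

  depthV≤depthD : ∀ D {v} → v ∈ toList (dverts D) → depthV v ≤ depthD D
  depthV≤depthD rootD v∈ with ∈-lookup⁻ (Vec.tabulate rootV) v∈
  ... | i , eq with trans eq (Vecₚ.lookup∘tabulate rootV i)
  depthV≤depthD rootD v∈ | zero , eq | refl = ≤-refl
  depthV≤depthD rootD v∈ | suc i , eq | refl = z≤n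
  depthV≤depthD (childD τ j) (here refl) = ≤-refl
  depthV≤depthD (childD τ j) (there v∈) = ℕₚ.m≤n⇒m≤1+n (depthV≤depthF τ v∈)

  -- Turns a bound on the depths of vertices into a bound on the depth of the facet.
  deepest : ∀ τ → ∃ λ v → v ∈ toList (fverts τ) × depthV v ≡ depthF τ
  deepest (rootF zero) = rootV (suc zero) , here refl , refl
  deepest (rootF (suc i)) = rootV zero , here refl , refl
  deepest (newF τ j i) = newV τ j , here refl , refl

  -- Makes the search for preimages in `locate` finite. Facets beyond depth m may occur as well; the
  -- search checks depths itself.
  tfacets : ℕ → List TFacet
  tfacets zero = map rootF (allFin (suc d))
  tfacets (suc m) = map rootF (allFin (suc d)) ++
    cartesianProductWith (λ { τ (j , i) → newF τ j i }) (tfacets m) (cartesianProduct (allFin k') (allFin d))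

  ∈-tfacets : ∀ m {τ} → depthF τ ≤ m → τ ∈ tfacets m
  ∈-tfacets zero {rootF i} _ = ∈-map⁺ rootF (∈-allFin i)
  ∈-tfacets (suc m) {rootF i} _ = ∈-++⁺ˡ (∈-map⁺ rootF (∈-allFin i))
  ∈-tfacets (suc m) {newF τ j i} (s≤s le) = ∈-++⁺ʳ (map rootF (allFin (suc d)))
    (∈-cartesianProductWith⁺ (λ { τ (j , i) → newF τ j i }) (∈-tfacets m le) (∈-cartesianProduct⁺ (∈-allFin j) (∈-allFin i)))

  vertices : ℕ → List Vtx
  vertices R = map rootV (allFin (suc d)) ++ cartesianProductWith newV (tfacets R) (allFin k')

  ∈-vertices : ∀ R {v} → depthV v ≤ R → v ∈ vertices R
  ∈-vertices R {rootV i} _ = ∈-++⁺ˡ (∈-map⁺ rootV (∈-allFin i))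
  ∈-vertices R {newV τ j} le = ∈-++⁺ʳ (map rootV (allFin (suc d)))
    (∈-cartesianProductWith⁺ newV (∈-tfacets R (≤-trans (ℕₚ.n≤1+n _) le)) (∈-allFin j))

  -- Evaluation in a tuple of Steiner systems

  module Eval {n : ℕ} (v₀ : Fin n) (σ : Vec (Fin n) d) (σ-unique : Unique (toList σ)) where

    Tuple : Set
    Tuple = Vec (Fam n) k

    φF : Tuple → Word → Vec (Fin n) d
    φF t [] = σ
    φF t ((c , i) ∷ w) = completion v₀ (lookup t c) (toList (φF t w)) ∷ removeAt (φF t w) i

    φ : Tuple → Addr → Fin n
    φ t (base i) = lookup σ i
    φ t (new w c) = completion v₀ (lookup t c) (toList (φF t w))

    φF≡map-φ : ∀ t w → φF t w ≡ Vec.map (φ t) (verts w)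
    φF≡map-φ t [] = trans (sym (Vecₚ.tabulate∘lookup σ)) (Vecₚ.tabulate-∘ (φ t) base)
    φF≡map-φ t ((c , i) ∷ w) = cong (φ t (new w c) ∷_)
      (trans (cong (λ v → removeAt v i) (φF≡map-φ t w)) (sym (map-removeAt (φ t) (verts w) i)))

    φF-toList : ∀ t w → toList (φF t w) ≡ map (φ t) (toList (verts w))
    φF-toList t w = trans (cong toList (φF≡map-φ t w)) (toList-map (φ t) (verts w))

    AllSteiner : Tuple → Set
    AllSteiner t = ∀ c → Steiner n d (lookup t c)

    module _ {t : Tuple} (S : AllSteiner t) where

      -- Mutual with `φ-block`: a facet without repetitions can be completed to a block, and the
      -- distinct vertices of that block make the next facet free of repetitions.
      φF-unique : ∀ w → Unique (toList (φF t w))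
      φ-block : ∀ w c → memF (lookup t c) (toSub (φ t (new w c) ∷ toList (φF t w))) ≡ true

      φF-unique [] = σ-unique
      φF-unique ((c , i) ∷ w) with block-unique (S c) (cong suc (length-toList (φF t w))) (φ-block w c)
      ... | p ∷ u = All.tabulate (λ q → All.lookup p (removeAt-⊆ (φF t w) i q)) ∷ removeAt-unique (φF t w) i u

      φ-block w c = completion-block v₀ (S c) (φF-unique w) (length-toList (φF t w))

      φ-block-unique : ∀ w c → Unique (φ t (new w c) ∷ toList (φF t w))
      φ-block-unique w c = block-unique (S c) (cong suc (length-toList (φF t w))) (φ-block w c)

      φ-new-∉ : ∀ w c → φ t (new w c) ∉ toList (φF t w)
      φ-new-∉ w c = Uniqueₚ.Unique[x∷xs]⇒x∉xs (φ-block-unique w c)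

    ∈-Ω⁻ : ∀ {t} → t ∈ Ω n d k → AllSteiner t
    ∈-Ω⁻ t∈ c = ∈-steinerSystems⁻ (∈-tuples⁻ t∈ c)

    ∈-Ω⁺ : ∀ {t} → AllSteiner t → t ∈ Ω n d k
    ∈-Ω⁺ {t} S = ∈-tuples⁺ t (∈-steinerSystems⁺ ∘ S)

    -- Switching two vertices in one of the systems

    switch : Fin k → Fin n → Fin n → Tuple → Tuple
    switch c x y t = updateAt t c (swapFam x y)

    switch-involutive : ∀ c x y t → switch c x y (switch c x y t) ≡ t
    switch-involutive c x y t = trans (Vecₚ.updateAt-updateAt c t)
      (Vecₚ.updateAt-id-local c t (swapFam-involutive x y (lookup t c)))

    switch-Steiner : ∀ c x y {t} → AllSteiner t → AllSteiner (switch c x y t)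
    switch-Steiner c x y {t} S c₁ with c₁ Finₚ.≟ c
    ... | yes refl rewrite lookup∘updateAt c {swapFam x y} t = swapFam-Steiner x y (S c)
    ... | no c₁≢c rewrite lookup∘updateAt′ c₁ c {swapFam x y} c₁≢c t = S c₁

    switch-block : ∀ c x y t l → memF (lookup t c) (toSub l) ≡ true →
                   memF (lookup (switch c x y t) c) (toSub (map (transpose x y) l)) ≡ true
    switch-block c x y t l p rewrite lookup∘updateAt c {swapFam x y} t = swapFam-block x y (lookup t c) l p

    transpose-fix-all : ∀ {x y : Fin n} {l} → x ∉ l → y ∉ l → map (transpose x y) l ≡ l
    transpose-fix-all {l = l} x∉ y∉ = map-id-local (All.tabulate λ {z} z∈ →
      transpose-fix (λ z≡x → x∉ (subst (_∈ l) z≡x z∈)) (λ z≡y → y∉ (subst (_∈ l) z≡y z∈)))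

    module _ (c : Fin k) {x y : Fin n} {t : Tuple} (S : AllSteiner t) where
      private
        t' : Tuple
        t' = switch c x y t

      switch-other-colour : ∀ {w c₁} → c₁ ≢ c → φF t' w ≡ φF t w → φ t' (new w c₁) ≡ φ t (new w c₁)
      switch-other-colour {w} {c₁} c₁≢c eq =
        cong₂ (λ F v → completion v₀ F (toList v)) (lookup∘updateAt′ c₁ c c₁≢c t) eq

      -- Steps in other colours consult an untouched system. A block of colour `c` used along `w`
      -- contains neither `x` nor `y`, so it is its own image and survives in the switched system,
      -- where completions are unique.
      switch-stable : ∀ w → x ∉ map (φ t) (supp w) → y ∉ map (φ t) (supp w) →
                      φF t' w ≡ φF t w × (∀ {a} → a ∈ supp w → φ t' a ≡ φ t a)
      switch-stable [] x∉ y∉ = refl , λ a∈ → base-stable (∈-supp-base⁻ a∈)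
        where
        base-stable : ∀ {a} → (∃ λ i → a ≡ base i) → φ t' a ≡ φ t a
        base-stable (_ , refl) = refl
      switch-stable ((c₁ , i) ∷ w) x∉ y∉ with switch-stable w (x∉ ∘ there) (y∉ ∘ there)
      ... | eqF , eq = cong₂ (λ z v → z ∷ removeAt v i) new-stable eqF ,
                       λ { (here refl) → new-stable ; (there a∈) → eq a∈ }
        where
        block = φ t (new w c₁) ∷ toList (φF t w)
        block⊆ : block ⊆ map (φ t) (supp ((c₁ , i) ∷ w))
        block⊆ (here p) = here p
        block⊆ (there p) with ∈-map⁻ (φ t) (subst (_ ∈_) (φF-toList t w) p)
        ... | b , b∈ , refl = there (∈-map⁺ (φ t) (verts⊆supp w b∈))
        new-stable : φ t' (new w c₁) ≡ φ t (new w c₁)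
        new-stable with c₁ Finₚ.≟ c
        ... | no c₁≢c = switch-other-colour {w} c₁≢c eqF
        ... | yes refl = trans (cong (completion v₀ (lookup t' c) ∘ toList) eqF)
          (completion-≡ v₀ (switch-Steiner c x y {t} S c) (length-toList (φF t w))
            (subst (λ l → memF (lookup t' c) (toSub l) ≡ true) (transpose-fix-all (x∉ ∘ block⊆) (y∉ ∘ block⊆))
              (switch-block c x y t block (φ-block {t} S w c))))

    -- The rare events

    Event : Config → Tuple → Set
    Event cf@(c , c₁ , v , q , ρ) t =
      c ≢ c₁ × φ t (new v c₁) ∉ map (φ t) (seen cf) ×
      memF (lookup t c) (toSub (φ t (new v c₁) ∷ map (φ t) (toList ρ))) ≡ true ×
      All (_∈ seen cf) (toList ρ)

    Event? : ∀ cf t → Dec (Event cf t)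
    Event? cf@(c , c₁ , v , q , ρ) t =
      ¬? (c Finₚ.≟ c₁) ×-dec ¬? (φ t (new v c₁) ∈?ᶠ map (φ t) (seen cf)) ×-dec
      (_ Bool.≟ true) ×-dec All.all? (_∈?ᵃ seen cf) (toList ρ)
      where open DecMembership (Finₚ._≟_ {n}) using () renaming (_∈?_ to _∈?ᶠ_)

    events : Config → List Tuple
    events cf = filter (Event? cf) (Ω n d k)

    -- Switching φ(new v c₁) with an arbitrary unseen y in the system c moves the block of the event to
    -- {y} ∪ φ(ρ) and changes nothing else that is seen, so both y and the original tuple can be recovered.
    unswitch : Config → Tuple → Tuple × Fin n
    unswitch (c , c₁ , v , q , ρ) t = switch c (φ t (new v c₁)) y t , y
      where y = completion v₀ (lookup t c) (map (φ t) (toList ρ))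

    unswitch-switch : ∀ (cf@(c , c₁ , v , q , ρ) : Config) {t y} → AllSteiner t → Event cf t → y ∉ map (φ t) (seen cf) →
                      unswitch cf (switch c (φ t (new v c₁)) y t) ≡ (t , y)
    unswitch-switch cf@(c , c₁ , v , q , ρ) {t} {y} S (c≢c₁ , s∉ , block , ρ⊆) y∉ =
      trans (cong₂ (λ s z → switch c s z t' , z) s≡ y≡) (cong (_, y) (switch-involutive c s y t))
      where
      s = φ t (new v c₁)
      t' = switch c s y t
      map-∉ : ∀ {z xs} → xs ⊆ seen cf → z ∉ map (φ t) (seen cf) → z ∉ map (φ t) xs
      map-∉ xs⊆ z∉ = z∉ ∘ Subsetₚ.map⁺ (φ t) xs⊆
      stable-v = switch-stable c {s} {y} {t} S v (map-∉ ∈-++⁺ˡ s∉) (map-∉ ∈-++⁺ˡ y∉)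
      stable-q = switch-stable c {s} {y} {t} S q (map-∉ (∈-++⁺ʳ (supp v)) s∉) (map-∉ (∈-++⁺ʳ (supp v)) y∉)
      stable : ∀ {a} → a ∈ seen cf → φ t' a ≡ φ t a
      stable a∈ with ∈-++⁻ (supp v) a∈
      ... | inj₁ p = proj₂ stable-v p
      ... | inj₂ p = proj₂ stable-q p
      -- `s` is found again in the switched tuple: its facet is stable, and it is completed in the
      -- unswitched colour `c₁`.
      s≡ : φ t' (new v c₁) ≡ s
      s≡ = switch-other-colour c {t = t} S {v} (c≢c₁ ∘ sym) (proj₁ stable-v)
      φρ = map (φ t) (toList ρ)
      φρ⊆ : φρ ⊆ map (φ t) (seen cf)
      φρ⊆ p with ∈-map⁻ (φ t) p
      ... | b , b∈ , refl = ∈-map⁺ (φ t) (All.lookup ρ⊆ b∈)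
      y≡ : completion v₀ (lookup t' c) (map (φ t') (toList ρ)) ≡ y
      y≡ = trans (cong (completion v₀ (lookup t' c)) (map-cong-local (All.map stable ρ⊆)))
        (completion-≡ v₀ (switch-Steiner c s y {t} S c) (trans (length-map (φ t) (toList ρ)) (length-toList ρ))
          (subst (λ l → memF (lookup t' c) (toSub l) ≡ true)
            (cong₂ _∷_ (transpose-left s y) (transpose-fix-all (s∉ ∘ φρ⊆) (y∉ ∘ φρ⊆)))
            (switch-block c s y t (s ∷ φρ) block)))

    -- Counts the pairs of a bad tuple t and a vertex y. Those with y seen number at most |seen| for
    -- each t. Every other pair is a value of `unswitch` on Ω, so there are at most |Ω| of them.
    events-rare : ∀ cf → n * length (events cf) ≤ weight cf * length (Ω n d k)
    events-rare cf@(c , c₁ , v , q , ρ) = begin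
      n * e                                          ≡⟨ ℕₚ.*-comm n e ⟩
      e * n                                          ≡⟨ cong (e *_) (sym (Listₚ.length-tabulate id)) ⟩
      e * length (allFin n)                          ≡⟨ sym (length-cartesianProductWith _,_ (events cf) (allFin n)) ⟩
      length (cartesianProduct (events cf) (allFin n)) ≤⟨ unique-⊆-length unique covered ⟩
      length (hit ++ close)                          ≡⟨ length-++ hit ⟩
      length hit + length close                      ≡⟨ cong₂ _+_ (length-map (unswitch cf) (Ω n d k))
                                                          (length-cartesianProductWith _ (events cf) (seen cf)) ⟩
      o + e * length (seen cf)                       ≤⟨ ℕₚ.+-monoʳ-≤ o
        (ℕₚ.*-monoˡ-≤ (length (seen cf)) (Listₚ.length-filter (Event? cf) (Ω n d k))) ⟩
      o + o * length (seen cf)                       ≡⟨ cong (o +_) (ℕₚ.*-comm o _) ⟩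
      weight cf * o                                  ∎
      where
      open ℕₚ.≤-Reasoning
      e = length (events cf)
      o = length (Ω n d k)
      hit = map (unswitch cf) (Ω n d k)
      close = cartesianProductWith (λ t a → t , φ t a) (events cf) (seen cf)
      unique : Unique (cartesianProduct (events cf) (allFin n))
      unique = Uniqueₚ.cartesianProduct⁺ (Uniqueₚ.filter⁺ (Event? cf) (Ω-unique n d k)) (Uniqueₚ.allFin⁺ n)
      covered : cartesianProduct (events cf) (allFin n) ⊆ hit ++ close
      covered {t , y} p with ∈-cartesianProduct⁻ (events cf) (allFin n) p
      ... | t∈ , _ with any? (λ a → φ t a Finₚ.≟ y) (seen cf)
      ... | yes q = let a , a∈ , eq = find q in
            ∈-++⁺ʳ hit (subst (λ z → (t , z) ∈ close) eq (∈-cartesianProductWith⁺ _ t∈ a∈))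
      ... | no q = ∈-++⁺ˡ (subst (_∈ hit) (unswitch-switch cf {t} S ev y∉)
            (∈-map⁺ (unswitch cf) (∈-Ω⁺ {switch c (φ t (new v c₁)) y t} (switch-Steiner c (φ t (new v c₁)) y {t} S))))
        where
        S = ∈-Ω⁻ {t} (proj₁ (∈-filter⁻ (Event? cf) t∈))
        ev = proj₂ (∈-filter⁻ (Event? cf) {xs = Ω n d k} t∈)
        y∉ : y ∉ map (φ t) (seen cf)
        y∉ r with ∈-map⁻ (φ t) r
        ... | a , a∈ , eq = q (lose a∈ (sym eq))

    all-events-rare : ∀ cfs → n * length (concatMap events cfs) ≤ sum (map weight cfs) * length (Ω n d k)
    all-events-rare [] = ℕₚ.≤-reflexive (ℕₚ.*-zeroʳ n)
    all-events-rare (cf ∷ cfs) = begin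
      n * length (events cf ++ concatMap events cfs)          ≡⟨ cong (n *_) (length-++ (events cf)) ⟩
      n * (length (events cf) + length (concatMap events cfs)) ≡⟨ ℕₚ.*-distribˡ-+ n (length (events cf)) _ ⟩
      n * length (events cf) + n * length (concatMap events cfs)
        ≤⟨ ℕₚ.+-mono-≤ (events-rare cf) (all-events-rare cfs) ⟩
      weight cf * length (Ω n d k) + sum (map weight cfs) * length (Ω n d k)
        ≡⟨ sym (ℕₚ.*-distribʳ-+ (length (Ω n d k)) (weight cf) _) ⟩
      (weight cf + sum (map weight cfs)) * length (Ω n d k) ∎
      where open ℕₚ.≤-Reasoning

    Generic : ℕ → Tuple → Set
    Generic R t = ¬ Any (λ cf → Event cf t) (configs R)

    Generic? : ∀ R t → Dec (Generic R t)
    Generic? R t = ¬? (any? (λ cf → Event? cf t) (configs R))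

    generics : ℕ → List Tuple
    generics R = filter (Generic? R) (Ω n d k)

    -- The union bound, cleared of denominators.
    generics-abundant : ∀ R →
      n * length (Ω n d k) ≤ n * length (generics R) + sum (map weight (configs R)) * length (Ω n d k)
    generics-abundant R = begin
      n * length (Ω n d k)
        ≤⟨ ℕₚ.*-monoʳ-≤ n (unique-⊆-length (Ω-unique n d k) covered) ⟩
      n * length (generics R ++ concatMap events (configs R))       ≡⟨ cong (n *_) (length-++ (generics R)) ⟩
      n * (length (generics R) + length (concatMap events (configs R))) ≡⟨ ℕₚ.*-distribˡ-+ n (length (generics R)) _ ⟩
      n * length (generics R) + n * length (concatMap events (configs R)) ≤⟨ ℕₚ.+-monoʳ-≤ _ (all-events-rare (configs R)) ⟩
      n * length (generics R) + sum (map weight (configs R)) * length (Ω n d k) ∎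
      where
      open ℕₚ.≤-Reasoning
      covered : Ω n d k ⊆ generics R ++ concatMap events (configs R)
      covered {t} t∈ with any? (λ cf → Event? cf t) (configs R)
      ... | no g = ∈-++⁺ˡ (∈-filter⁺ (Generic? R) t∈ g)
      ... | yes ev = ∈-++⁺ʳ (generics R) (∈-concatMap⁺ events (Any.map (λ {cf} → ∈-filter⁺ (Event? cf) t∈) ev))

    -- Injectivity of the evaluation for generic tuples

    module Injectivity {R : ℕ} {t : Tuple} (S : AllSteiner t) (generic : Generic R t) where

      no-event : ∀ {c c₁ v q ρ} → length v ≤ R → length q ≤ R → c ≢ c₁ →
        φ t (new v c₁) ∉ map (φ t) (supp v ++ supp q) →
        memF (lookup t c) (toSub (φ t (new v c₁) ∷ map (φ t) (toList ρ))) ≡ true →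
        toList ρ ⊆ supp v ++ supp q → ⊥
      no-event {c} {c₁} {v} {q} {ρ} v≤ q≤ c≢c₁ s∉ block ρ⊆ =
        generic (lose (∈-configs R {c} {c₁} {v} {q} {ρ} v≤ q≤ λ x∈ →
                        [ (λ p → ≤-trans (supp-depth v p) v≤) , (λ p → ≤-trans (supp-depth q p) q≤) ]′
                          (∈-++⁻ (supp v) (ρ⊆ x∈)))
                      (c≢c₁ , s∉ , block , All.tabulate ρ⊆))

      φ-∉-seen : ∀ {z} v q → (∀ {x} → x ∈ supp v → φ t z ≢ φ t x) → (∀ {x} → x ∈ supp q → φ t z ≢ φ t x) →
                 φ t z ∉ map (φ t) (supp v ++ supp q)
      φ-∉-seen v q f g p with ∈-map⁻ (φ t) p
      ... | x , x∈ , eq with ∈-++⁻ (supp v) x∈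
      ... | inj₁ x∈v = f x∈v eq
      ... | inj₂ x∈q = g x∈q eq

      -- The measure for minimal coincidences. `clash-outside` compares z, one level below `a`, with
      -- still lower vertices, and the new pair must come before (a, b) even when `b` is shallow.
      -- Sums of depths fail here; powers of two work, as 2^m + 2^l < 2^(m+1) for l < m.
      size : Addr → ℕ
      size a = 2 ^ depth a

      size-mono : ∀ {a b} → depth a ≤ depth b → size a ≤ size b
      size-mono = ℕₚ.^-monoʳ-≤ 2

      Distinct< : ℕ → Set
      Distinct< N = ∀ a b → ValidAddr a → ValidAddr b → depth a ≤ R → depth b ≤ R → size a + size b < N →
                    a ≢ b → φ t a ≢ φ t b

      -- The newest vertex φ(new w₀ c₀) of the facet completed by a lies outside the support of b: switch it.
      clash-outside : ∀ {c c₀ i w₀ b} → let a = new ((c₀ , i) ∷ w₀) c ; z = new w₀ c₀ in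
        ValidAddr a → ValidAddr b → depth a ≤ R → depth b ≤ R → Distinct< (size a + size b) →
        z ∉ supp (wordOf b) → φ t a ≡ φ t b → ⊥
      clash-outside {c} {c₀} {i} {w₀} {b} va@(c≢c₀ , vz@(_ , vw₀)) vb a≤ b≤ IH z∉ eq =
        -- `b` stands in for `a`, whose image it shares; with the d - 1 kept entries of `verts w₀`
        -- it makes up ρ. Validity of `a` provides c ≢ c₀.
        no-event {c} {c₀} {w₀} {wordOf b} {b ∷ removeAt (verts w₀) i} w₀≤ q≤ c≢c₀
          (φ-∉-seen {z} w₀ (wordOf b) z≢old z≢b) block ρ⊆
        where
        z = new w₀ c₀
        z≤ : suc (length w₀) ≤ R
        z≤ = ≤-trans (ℕₚ.n≤1+n _) a≤
        w₀≤ : length w₀ ≤ R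
        w₀≤ = ≤-trans (ℕₚ.n≤1+n _) z≤
        q≤ : length (wordOf b) ≤ R
        q≤ = ≤-trans (ℕₚ.≤-reflexive (length-wordOf b)) b≤
        size-z< : size z < 2 ^ suc (suc (length w₀))
        size-z< = ℕₚ.^-monoʳ-< 2 (s≤s (s≤s z≤n)) (ℕₚ.n<1+n (suc (length w₀)))
        z≢old : ∀ {x} → x ∈ supp w₀ → φ t z ≢ φ t x
        z≢old {x} x∈ = IH z x vz (supp-valid w₀ vw₀ x∈) z≤ (≤-trans x≤ w₀≤)
          (ℕₚ.<-≤-trans (ℕₚ.+-monoʳ-< (size z) size-x<)
            (≤-trans (ℕₚ.≤-reflexive (cong (size z +_) (sym (ℕₚ.+-identityʳ _)))) (ℕₚ.m≤m+n _ (size b))))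
          λ { refl → ℕₚ.<-irrefl refl x≤ }
          where
          x≤ = supp-depth w₀ x∈
          size-x< : size x < size z
          size-x< = ℕₚ.^-monoʳ-< 2 (s≤s (s≤s z≤n)) (s≤s x≤)
        z≢b : ∀ {x} → x ∈ supp (wordOf b) → φ t z ≢ φ t x
        z≢b {x} x∈ = IH z x vz (supp-valid (wordOf b) vb x∈) z≤ (≤-trans x≤ b≤)
          (ℕₚ.+-mono-<-≤ size-z< (size-mono {x} {b} x≤)) λ { refl → z∉ x∈ }
          where
          x≤ : depth x ≤ depth b
          x≤ = ≤-trans (supp-depth (wordOf b) x∈) (ℕₚ.≤-reflexive (length-wordOf b))
        rest = toList (removeAt (φF t w₀) i)
        block : memF (lookup t c) (toSub (φ t z ∷ φ t b ∷ map (φ t) (toList (removeAt (verts w₀) i)))) ≡ true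
        block = subst (λ s → memF (lookup t c) s ≡ true)
          (trans (cong (λ u → toSub (u ∷ φ t z ∷ rest)) eq)
            (trans (toSub-cong {l = φ t b ∷ φ t z ∷ rest} {φ t z ∷ φ t b ∷ rest} (swap , swap))
              (cong (λ l → toSub (φ t z ∷ φ t b ∷ l))
                (trans (cong (λ v → toList (removeAt v i)) (φF≡map-φ t w₀))
                  (trans (cong toList (sym (map-removeAt (φ t) (verts w₀) i))) (toList-map (φ t) _))))))
          (φ-block {t} S ((c₀ , i) ∷ w₀) c)
          where
          swap : ∀ {x y : Fin n} {l} → x ∷ y ∷ l ⊆ y ∷ x ∷ l
          swap (here p) = there (here p)
          swap (there (here p)) = here p
          swap (there (there p)) = there (there p)
        ρ⊆ : toList (b ∷ removeAt (verts w₀) i) ⊆ supp w₀ ++ supp (wordOf b)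
        ρ⊆ (here refl) = ∈-++⁺ʳ (supp w₀) (∈-supp-wordOf b)
        ρ⊆ (there p) = ∈-++⁺ˡ (verts⊆supp w₀ (removeAt-⊆ (verts w₀) i p))

      -- Here the common image φ(b) itself is switched.
      clash-colours : ∀ {w w' c c'} → let a = new w c ; b = new w' c' in
        ValidAddr a → ValidAddr b → depth a ≤ R → depth b ≤ R → Distinct< (size a + size b) →
        length w ≡ length w' → c ≢ c' → φ t a ≡ φ t b → ⊥
      clash-colours {w} {w'} {c} {c'} (_ , vw) vb@(_ , vw') a≤ b≤ IH len c≢c' eq =
        no-event {c} {c'} {w'} {w} {verts w} w'≤ (≤-trans (ℕₚ.n≤1+n _) a≤) c≢c'
          (φ-∉-seen {b} w' w (apart vw' (ℕₚ.≤-reflexive (sym len)) ≤-refl) (apart vw ≤-refl (ℕₚ.≤-reflexive len)))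
          (subst₂ (λ u l → memF (lookup t c) (toSub (u ∷ l)) ≡ true) eq (φF-toList t w) (φ-block {t} S w c))
          (λ p → ∈-++⁺ʳ (supp w') (verts⊆supp w p))
        where
        b = new w' c'
        w'≤ : length w' ≤ R
        w'≤ = ≤-trans (ℕₚ.n≤1+n _) b≤
        -- As both words have the same length, every x here is shallower than both addresses:
        -- shallower than `b`, so different from it, and shallower than `a`, so the pair (b, x) is
        -- smaller than (a, b).
        apart : ∀ {u} → Valid u → length u ≤ length w → length u ≤ length w' → ∀ {x} → x ∈ supp u → φ t b ≢ φ t x
        apart {u} vu u≤w u≤w' {x} x∈ = IH b x vb (supp-valid u vu x∈) b≤ (≤-trans x≤ (≤-trans u≤w' w'≤))
          (ℕₚ.<-≤-trans (ℕₚ.+-monoʳ-< (size b) (ℕₚ.^-monoʳ-< 2 (s≤s (s≤s z≤n)) (s≤s (≤-trans x≤ u≤w))))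
            (ℕₚ.≤-reflexive (ℕₚ.+-comm (size b) _)))
          λ { refl → ℕₚ.<-irrefl refl (≤-trans x≤ u≤w') }
          where x≤ = supp-depth u x∈

      -- Two facets of one block share d - 1 vertices, so with a common completing vertex they share a d-set.
      facets-completion-≢ : ∀ w c i j → i ≢ j → ∀ c' →
        φ t (new ((c , i) ∷ w) c') ≢ φ t (new ((c , j) ∷ w) c')
      facets-completion-≢ w c i j i≢j c' eq with removeAt-∩ (φF t w) i≢j (φF-unique {t} S w)
      -- Sharing u, z and `l`, the blocks U and U' coincide; yet the j-th old vertex lies in U and
      -- was omitted from U'.
      ... | l , ul , len , l⊆i , l⊆j = not-in (proj₁ same (there (there (lookup-∈-removeAt (φF t w) i≢j))))
        where
        z = φ t (new w c)
        u = φ t (new ((c , i) ∷ w) c')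
        U = u ∷ z ∷ toList (removeAt (φF t w) i)
        U' = u ∷ z ∷ toList (removeAt (φF t w) j)
        blockU : memF (lookup t c') (toSub U) ≡ true
        blockU = φ-block {t} S ((c , i) ∷ w) c'
        blockU' : memF (lookup t c') (toSub U') ≡ true
        blockU' = subst (λ x → memF (lookup t c') (toSub (x ∷ z ∷ toList (removeAt (φF t w) j))) ≡ true) (sym eq)
                        (φ-block {t} S ((c , j) ∷ w) c')
        U-unique : Unique U
        U-unique = φ-block-unique {t} S ((c , i) ∷ w) c'
        common⊆ : ∀ {l'} → l ⊆ l' → u ∷ z ∷ l ⊆ u ∷ z ∷ l'
        common⊆ f (here p) = here p
        common⊆ f (there (here p)) = there (here p)
        common⊆ f (there (there p)) = there (there (f p))
        common-unique : Unique (u ∷ z ∷ l)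
        common-unique with U-unique
        ... | (u≢z ∷ u∉) ∷ z∉ ∷ _ =
          (u≢z ∷ All.tabulate (λ p → All.lookup u∉ (l⊆i p))) ∷ All.tabulate (λ p → All.lookup z∉ (l⊆i p)) ∷ ul
        same : U ≈ₛ U'
        same = block-determined (S c') common-unique (cong suc len) blockU (common⊆ l⊆i) blockU' (common⊆ l⊆j)
        not-in : lookup (φF t w) j ∉ U'
        not-in (here p) = Uniqueₚ.Unique[x∷xs]⇒x∉xs U-unique
          (subst (_∈ z ∷ toList (removeAt (φF t w) i)) p (there (lookup-∈-removeAt (φF t w) i≢j)))
        not-in (there (here p)) = φ-new-∉ {t} S w c (subst (_∈ toList (φF t w)) p (lookup-∈ (φF t w) j))
        not-in (there (there p)) = lookup-∉-removeAt (φF t w) j (φF-unique {t} S w) p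

      φ-verts-≢ : ∀ {w c x} → x ∈ toList (verts w) → φ t (new w c) ≢ φ t x
      φ-verts-≢ {w} {c} x∈ eq = φ-new-∉ {t} S w c
        (subst₂ _∈_ (sym eq) (sym (φF-toList t w)) (∈-map⁺ (φ t) x∈))

      -- Strong induction on the measure, run as induction on a strict bound; `clash` receives all
      -- smaller pairs as its hypothesis.
      distinct : ∀ N → Distinct< N
      distinct (suc N) a b va vb a≤ b≤ (s≤s size≤) a≢b = clash a b va vb a≤ b≤ a≢b
          (λ x y vx vy x≤ y≤ lt → distinct N x y vx vy x≤ y≤ (ℕₚ.<-≤-trans lt size≤))
        where
        flip : ∀ {a b} → Distinct< (size a + size b) → Distinct< (size b + size a)
        flip {a} {b} = subst Distinct< (ℕₚ.+-comm (size a) (size b))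

        new∉base : ∀ {w c} → new w c ∉ supp []
        new∉base p with ∈-supp-base⁻ p
        ... | _ , ()

        Clash : Addr → Addr → Set
        Clash a b = ValidAddr a → ValidAddr b → depth a ≤ R → depth b ≤ R → a ≢ b →
                    Distinct< (size a + size b) → φ t a ≢ φ t b

        flip-clash : ∀ {a b} → Clash a b → Clash b a
        flip-clash {a} {b} h vb va b≤ a≤ b≢a IH eq = h va vb a≤ b≤ (b≢a ∘ sym) (flip {b} {a} IH) (sym eq)

        clash-base : ∀ w c i → Clash (new w c) (base i)
        clash-base [] c i va vb a≤ b≤ a≢b IH eq = φ-verts-≢ (∈-supp-base⁺ i) eq
        clash-base (_ ∷ _) c i va vb a≤ b≤ a≢b IH eq = clash-outside va vb a≤ b≤ IH new∉base eq

        clash-first : ∀ w c c' → Clash (new w c) (new [] c')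
        clash-first [] c c' va vb a≤ b≤ a≢b IH eq = clash-colours va vb a≤ b≤ IH refl (λ { refl → a≢b refl }) eq
        clash-first w@((c₀ , i) ∷ w₀) c c' va vb a≤ b≤ a≢b IH eq with new w₀ c₀ ∈?ᵃ supp (wordOf (new [] c'))
        ... | no z∉ = clash-outside va vb a≤ b≤ IH z∉ eq
        ... | yes (here refl) = φ-verts-≢ {w} (here refl) eq
        ... | yes (there z∈) = new∉base z∈

        clash-siblings : ∀ w c₀ i i' c c' → Clash (new ((c₀ , i) ∷ w) c) (new ((c₀ , i') ∷ w) c')
        clash-siblings w c₀ i i' c c' va vb a≤ b≤ a≢b IH eq with c Finₚ.≟ c' | i Finₚ.≟ i'
        ... | no c≢c' | _ = clash-colours va vb a≤ b≤ IH refl c≢c' eq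
        ... | yes refl | yes refl = a≢b refl
        ... | yes refl | no i≢i' = facets-completion-≢ w c₀ i i' i≢i' c eq

        clash : ∀ a b → Clash a b
        clash (base i) (base j) _ _ _ _ a≢b _ eq = a≢b (cong base (lookup-injective σ σ-unique i j eq))
        clash (new w c) (base i) = clash-base w c i
        clash (base i) (new w c) = flip-clash (clash-base w c i)
        clash (new w c) (new [] c') = clash-first w c c'
        clash (new [] c) (new w@(_ ∷ _) c') = flip-clash (clash-first w c' c)
        clash a@(new w@((c₀ , i) ∷ w₀) c) b@(new w'@((c₀' , i') ∷ w₀') c') va vb a≤ b≤ a≢b IH eq
          with new w₀ c₀ ∈?ᵃ supp (wordOf b) | new w₀' c₀' ∈?ᵃ supp (wordOf a)
        ... | no z∉ | _ = clash-outside va vb a≤ b≤ IH z∉ eq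
        ... | _ | no z'∉ = clash-outside vb va b≤ a≤ (flip {a} {b} IH) z'∉ (sym eq)
        -- The support of `b` lists `b`, then the newest vertex z' of its facet, then what came
        -- earlier. Here z = b, so `b` lies on the facet that `a` completes.
        ... | yes (here refl) | _ = φ-verts-≢ {w} (here refl) eq
        ... | _ | yes (here refl) = φ-verts-≢ {w'} (here refl) (sym eq)
        ... | yes (there (here refl)) | _ = clash-siblings w₀ c₀ i i' c c' va vb a≤ b≤ a≢b IH eq
        ... | _ | yes (there (here refl)) = clash-siblings w₀ c₀ i i' c c' va vb a≤ b≤ a≢b IH eq
        -- Each of the two newest vertices would have to be strictly deeper than the other.
        ... | yes (there (there p)) | yes (there (there p')) =
          ℕₚ.<-irrefl refl (≤-trans (supp-depth w₀' p) (≤-trans (ℕₚ.n≤1+n _) (supp-depth w₀ p')))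

      φ-injective : ∀ {a b} → ValidAddr a → ValidAddr b → depth a ≤ R → depth b ≤ R → φ t a ≡ φ t b → a ≡ b
      φ-injective {a} {b} va vb a≤ b≤ eq with a ≟ᵃ b
      ... | yes a≡b = a≡b
      ... | no a≢b = contradiction eq (distinct (suc (size a + size b)) a b va vb a≤ b≤ ≤-refl a≢b)

    -- Comparison of the ball in X with the ball in the tree

    module LocalStructure {t : Tuple} (S : AllSteiner t) where

      private
        X T : Complex
        X = XCx n d k t
        T = TCx
        module X = Nb X d
        module T = Nb T d

      ψ : Vtx → Fin n
      ψ v = φ t (embV v)

      map-ψ-fverts : ∀ τ → map ψ (toList (fverts τ)) ≡ toList (φF t (embF τ))
      map-ψ-fverts τ = begin
        map ψ (toList (fverts τ))                    ≡⟨ map-∘ (toList (fverts τ)) ⟩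
        map (φ t) (map embV (toList (fverts τ)))     ≡⟨ cong (map (φ t)) (toList-map embV (fverts τ)) ⟨
        map (φ t) (toList (Vec.map embV (fverts τ))) ≡⟨ cong (map (φ t) ∘ toList) (verts-embF τ) ⟨
        map (φ t) (toList (verts (embF τ)))          ≡⟨ φF-toList t (embF τ) ⟨
        toList (φF t (embF τ))                       ∎
        where open ≡-Reasoning

      ψ-block : ∀ D → memF (lookup t (colourD D)) (toSub (map ψ (toList (dverts D)))) ≡ true
      ψ-block rootD = subst (λ l → memF (lookup t zero) (toSub (ψ (rootV zero) ∷ l)) ≡ true)
        (sym (map-ψ-fverts (rootF zero))) (φ-block {t} S [] zero)
      ψ-block (childD τ j) = subst (λ l → memF (lookup t (punchIn (colourF τ) j)) (toSub (ψ (newV τ j) ∷ l)) ≡ true)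
        (sym (map-ψ-fverts τ)) (φ-block {t} S (embF τ) (punchIn (colourF τ) j))

      ψ-dverts-length : ∀ D → length (map ψ (toList (dverts D))) ≡ suc d
      ψ-dverts-length D = trans (length-map ψ (toList (dverts D))) (length-toList (dverts D))

      ψ-dverts-unique : ∀ D → Unique (map ψ (toList (dverts D)))
      ψ-dverts-unique D = block-unique (S (colourD D)) (ψ-dverts-length D) (ψ-block D)

      -- Read off from X: the images form a block and are distinct, so the tree vertices are.
      dverts-unique : ∀ D → Unique (toList (dverts D))
      dverts-unique D = Uniqueₚ.map⁻ (ψ-dverts-unique D)

      -- Injectivity within one d-face follows from its block alone. It already suffices to carry
      -- walks from the tree to X at any radius.
      ψ-injective-on : ∀ D {u v} → u ∈ toList (dverts D) → v ∈ toList (dverts D) → ψ u ≡ ψ v → u ≡ v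
      ψ-injective-on D = unique-map-injective ψ (ψ-dverts-unique D)

      ψ-unique : ∀ D {l} → l ⊆ toList (dverts D) → Unique l → Unique (map ψ l)
      ψ-unique D l⊆ = unique-map⁺ ψ (λ u∈ v∈ → ψ-injective-on D (l⊆ u∈) (l⊆ v∈))

      facetOf⊆ : ∀ D i → toList (fverts (facetOf D i)) ⊆ toList (dverts D)
      facetOf⊆ D i rewrite fverts-facetOf D i = removeAt-⊆ (dverts D) i

      facetOf-T : ∀ D i → T.Facet (toList (fverts (facetOf D i)))
      facetOf-T D i = subst (Unique ∘ toList) (sym (fverts-facetOf D i)) (removeAt-unique (dverts D) i (dverts-unique D)) ,
        length-toList (fverts (facetOf D i)) , D , facetOf⊆ D i

      facet-T : ∀ τ → T.Facet (toList (fverts τ))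
      facet-T τ = let i , eq = facetOf-parentD τ in
        subst (λ τ' → T.Facet (toList (fverts τ'))) (sym eq) (facetOf-T (parentD τ) i)

      facetOf-adjacent : ∀ D {i j} → i ≢ j → T.Adj (toList (fverts (facetOf D i))) (toList (fverts (facetOf D j)))
      facetOf-adjacent D {i} {j} i≢j = facetOf-T D i , facetOf-T D j , not-same ,
          toList (dverts D) , (dverts-unique D , length-toList (dverts D) , D , id) , covers , covered
        where
        not-same : ¬ (toList (fverts (facetOf D i)) ≈ₛ toList (fverts (facetOf D j)))
        not-same (p , _) rewrite fverts-facetOf D i | fverts-facetOf D j =
          lookup-∉-removeAt (dverts D) j (dverts-unique D) (p (lookup-∈-removeAt (dverts D) i≢j))
        covers : toList (dverts D) ⊆ toList (fverts (facetOf D i)) ++ toList (fverts (facetOf D j))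
        covers {v} v∈ rewrite fverts-facetOf D i | fverts-facetOf D j with v ≟ᵛ lookup (dverts D) i
        ... | yes refl = ∈-++⁺ʳ (toList (removeAt (dverts D) i)) (lookup-∈-removeAt (dverts D) (i≢j ∘ sym))
        ... | no v≢ = ∈-++⁺ˡ (∈-removeAt⁺ (dverts D) i v∈ v≢)
        covered : toList (fverts (facetOf D i)) ++ toList (fverts (facetOf D j)) ⊆ toList (dverts D)
        covered v∈ = [ facetOf⊆ D i , facetOf⊆ D j ]′ (∈-++⁻ (toList (fverts (facetOf D i))) v∈)

      withinT : ∀ τ → T.Within rootFacet (depthF τ) (toList (fverts τ))
      withinT (rootF zero) = Nb.here (facetOf-T rootD zero) (id , id)
      withinT (rootF (suc i)) = Nb.step (withinT (rootF zero)) (facetOf-adjacent rootD {zero} {suc i} λ ())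
      withinT (newF τ j i) = Nb.step (withinT τ) (facetOf-adjacent (childD τ j) {zero} {suc i} λ ())

      facetOf-of-⊆ : ∀ D {l} → Unique l → length l ≡ d → l ⊆ toList (dverts D) → ∃ λ i → l ≈ₛ toList (fverts (facetOf D i))
      facetOf-of-⊆ D u len l⊆ = let i , e = removeAt-of-⊆ _≟ᵛ_ (dverts D) (dverts-unique D) u len l⊆ in
        i , subst (λ v → _ ≈ₛ toList v) (sym (fverts-facetOf D i)) e

      -- Complements `withinT`: a step leads into a d-face of depth at most one more than the radius
      -- reached so far.
      withinT-depth : ∀ {r l} → T.Within rootFacet r l → ∀ {v} → v ∈ l → depthV v ≤ r
      withinT-depth (Nb.here _ (l⊆ , _)) v∈ = ≤-trans (depthV≤depthF (rootF zero) (l⊆ v∈)) z≤n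
      withinT-depth {suc r} (Nb.step w ((u , len , _) , _ , _ , e , (_ , _ , D , e⊆) , _ , ⊆e)) v∈ =
        ≤-trans (depthV≤depthD D (e⊆ (⊆e (∈-++⁺ʳ _ v∈)))) (depthD≤ D (facetOf-of-⊆ D u len (e⊆ ∘ ⊆e ∘ ∈-++⁺ˡ)))
        where
        -- If the step starts from the attaching facet τ, the deepest vertex of τ bounds its depth
        -- by r. Any other facet of the child contains the new vertex, which has the depth of the
        -- whole d-face.
        depthD≤ : ∀ D → (∃ λ i → _ ≈ₛ toList (fverts (facetOf D i))) → depthD D ≤ suc r
        depthD≤ rootD _ = s≤s z≤n
        depthD≤ (childD τ j) (zero , _ , ⊇) = let v , v∈ , eq = deepest τ in
          s≤s (subst (_≤ r) eq (withinT-depth w (⊇ v∈)))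
        depthD≤ (childD τ j) (suc i , _ , ⊇) = ℕₚ.m≤n⇒m≤1+n (withinT-depth w (⊇ (here refl)))

      facet-X : ∀ {l} → Unique l → length l ≡ d → X.Facet l
      facet-X {l} u len = u , len , inj₁ (subst (card (toSub l) ≤_) len (card-toSub-≤ l))

      dface-X : ∀ D {l} → Unique l → length l ≡ suc d → l ⊆ toList (dverts D) → X.DFace (map ψ l)
      dface-X D {l} u len l⊆ = ψ-unique D l⊆ u , trans (length-map ψ l) len ,
        inj₂ (colourD D , subst (λ s → memF (lookup t (colourD D)) s ≡ true) (toSub-cong (≈ₛ-map ψ (⊆l , l⊆))) (ψ-block D))
        where
        ⊆l : toList (dverts D) ⊆ l
        ⊆l = unique-⊆-⊇ _≟ᵛ_ u l⊆ (ℕₚ.≤-reflexive (trans (length-toList (dverts D)) (sym len)))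

      withinT⇒X : ∀ {r l} → T.Within rootFacet r l → X.Within (toList σ) r (map ψ l)
      withinT⇒X {l = l} (Nb.here (u , len , D , l⊆) e) =
        Nb.here (facet-X (ψ-unique D l⊆ u) (trans (length-map ψ l) len))
          (subst (map ψ l ≈ₛ_) (map-ψ-fverts (rootF zero)) (≈ₛ-map ψ e))
      withinT⇒X (Nb.step {τ = l} {l'} w ((u , len , _) , (u' , len' , _) , ≉ , e , (ue , lene , D , e⊆) , e≈)) =
        Nb.step (withinT⇒X w)
          ( facet-X (ψ-unique D (e⊆ ∘ proj₂ e≈ ∘ ∈-++⁺ˡ) u) (trans (length-map ψ l) len)
          , facet-X (ψ-unique D l'⊆ u') (trans (length-map ψ l') len')
          , (λ (p , q) → ≉ (reflect l⊆ l'⊆ p , reflect l'⊆ l⊆ q))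
          , map ψ e , dface-X D ue lene e⊆ , subst (map ψ e ≈ₛ_) (map-++ ψ l l') (≈ₛ-map ψ e≈))
        where
        l⊆ : l ⊆ toList (dverts D)
        l⊆ = e⊆ ∘ proj₂ e≈ ∘ ∈-++⁺ˡ
        l'⊆ : l' ⊆ toList (dverts D)
        l'⊆ = e⊆ ∘ proj₂ e≈ ∘ ∈-++⁺ʳ l
        reflect : ∀ {a b} → a ⊆ toList (dverts D) → b ⊆ toList (dverts D) → map ψ a ⊆ map ψ b → a ⊆ b
        reflect {a} {b} a⊆ b⊆ sub {v} v∈ with ∈-map⁻ ψ (sub (∈-map⁺ ψ v∈))
        ... | v' , v'∈ , eq = subst (_∈ b) (sym (ψ-injective-on D (a⊆ v∈) (b⊆ v'∈) eq)) v'∈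

      -- The lifting property. Its cardinality makes the d-face a block of some colour c; `faceAt`
      -- supplies a tree d-face of that colour at τ, and two blocks of one system over the same
      -- d-set agree.
      dface-at : ∀ τ {u} → X.DFace u → map ψ (toList (fverts τ)) ⊆ u →
        ∃ λ D → ∃ λ i → τ ≡ facetOf D i × depthD D ≤ suc (depthF τ) × u ≈ₛ map ψ (toList (dverts D))
      dface-at τ {u} (uu , lenu , inj₁ small) _ =
        contradiction small (subst (λ m → ¬ (m ≤ d)) (sym (trans (card-toSub uu) lenu)) (ℕₚ.<⇒≱ ≤-refl))
      dface-at τ {u} (uu , lenu , inj₂ (c , block)) τ⊆u with faceAt τ c
      ... | D , i , refl , refl , depth≤ = D , i , refl , depth≤ ,
        block-determined (S (colourD D)) (subst Unique (sym (map-ψ-fverts τ)) (φF-unique {t} S (embF τ)))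
          (trans (length-map ψ (toList (fverts τ))) (length-toList (fverts τ)))
          block τ⊆u (ψ-block D) (Subsetₚ.map⁺ ψ (facetOf⊆ D i))

      -- Lifts a walk in X to the tree step by step through `dface-at`, with each step adding at
      -- most one to the depth.
      withinX-facet : ∀ {r l} → X.Within (toList σ) r l → ∃ λ τ → depthF τ ≤ r × l ≈ₛ map ψ (toList (fverts τ))
      withinX-facet {l = l} (Nb.here _ e) = rootF zero , z≤n , subst (l ≈ₛ_) (sym (map-ψ-fverts (rootF zero))) e
      withinX-facet (Nb.step {τ = l} {l'} w (_ , (u' , len' , _) , _ , e , de , e⊆ , ⊆e)) with withinX-facet w
      ... | τ , τ≤ , _ , τ⊆l with dface-at τ de (⊆e ∘ ∈-++⁺ˡ ∘ τ⊆l)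
      ... | D , i , refl , D≤ , e⊆D , _ with removeAt-of-⊆ Finₚ._≟_ (Vec.map ψ (dverts D))
                (subst Unique (sym (toList-map ψ (dverts D))) (ψ-dverts-unique D)) u' len'
                (subst (_ ∈_) (sym (toList-map ψ (dverts D))) ∘ e⊆D ∘ ⊆e ∘ ∈-++⁺ʳ l)
      ... | j , l'≈ = facetOf D j , ≤-trans (depthF-facetOf D j) (≤-trans D≤ (s≤s τ≤)) , subst (l' ≈ₛ_) eq l'≈
        where
        eq : toList (removeAt (Vec.map ψ (dverts D)) j) ≡ map ψ (toList (fverts (facetOf D j)))
        eq = trans (cong toList (trans (sym (map-removeAt ψ (dverts D) j)) (cong (Vec.map ψ) (sym (fverts-facetOf D j)))))
                   (toList-map ψ (fverts (facetOf D j)))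

      -- Injectivity is required one level beyond the radius: a d-face of the ball in X lifts to a
      -- tree d-face whose depth is bounded only by r + 1.
      module _ (r : ℕ) (ψ-injective : ∀ {u v} → depthV u ≤ suc r → depthV v ≤ suc r → ψ u ≡ ψ v → u ≡ v) where

        locate : ∀ x → Dec (Any (λ v → depthV v ≤ suc r × ψ v ≡ x) (vertices (suc r)))
        locate x = any? (λ v → (depthV v ℕₚ.≤? suc r) ×-dec (ψ v Finₚ.≟ x)) (vertices (suc r))

        -- Outside the image of the ball of radius r + 1 the value is arbitrary.
        ψ⁻¹ : Fin n → Vtx
        ψ⁻¹ x with locate x
        ... | yes p = proj₁ (find p)
        ... | no _ = rootV zero

        ψ⁻¹-ψ : ∀ {v} → depthV v ≤ suc r → ψ⁻¹ (ψ v) ≡ v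
        ψ⁻¹-ψ {v} v≤ with locate (ψ v)
        ... | yes p = let _ , _ , u≤ , eq = find p in ψ-injective u≤ v≤ eq
        ... | no ¬p = contradiction (lose (∈-vertices (suc r) v≤) (v≤ , refl)) ¬p

        map-ψ⁻¹-ψ : ∀ {l} → (∀ {v} → v ∈ l → depthV v ≤ suc r) → map ψ⁻¹ (map ψ l) ≡ l
        map-ψ⁻¹-ψ {l} l≤ = trans (sym (map-∘ l)) (map-id-local (All.tabulate (ψ⁻¹-ψ ∘ l≤)))

        withinX⇒T : ∀ {l} → X.Within (toList σ) r l → T.Within rootFacet r (map ψ⁻¹ l) ×
                    (∀ {x} → x ∈ l → ∃ λ v → depthV v ≤ r × x ≡ ψ v)
        withinX⇒T {l} w with withinX-facet w | within-facet w
        ... | τ , τ≤ , l≈@(l⊆ , _) | u , len , _ = within-resp (within-≤ τ≤ (withinT τ)) facet (≈ₛ-sym l≈τ) , preimage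
          where
          τ≤r : ∀ {v} → v ∈ toList (fverts τ) → depthV v ≤ r
          τ≤r v∈ = ≤-trans (depthV≤depthF τ v∈) τ≤
          l≈τ : map ψ⁻¹ l ≈ₛ toList (fverts τ)
          l≈τ = subst (map ψ⁻¹ l ≈ₛ_) (map-ψ⁻¹-ψ (ℕₚ.m≤n⇒m≤1+n ∘ τ≤r)) (≈ₛ-map ψ⁻¹ l≈)
          preimage : ∀ {x} → x ∈ l → ∃ λ v → depthV v ≤ r × x ≡ ψ v
          preimage x∈ = let v , v∈ , eq = ∈-map⁻ ψ (l⊆ x∈) in v , τ≤r v∈ , eq
          facet : T.Facet (map ψ⁻¹ l)
          facet = unique-map⁺ ψ⁻¹ inj u , trans (length-map ψ⁻¹ l) len ,
                  let _ , _ , D , τ⊆ = facet-T τ in D , τ⊆ ∘ proj₁ l≈τ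
            where
            inj : ∀ {x y} → x ∈ l → y ∈ l → ψ⁻¹ x ≡ ψ⁻¹ y → x ≡ y
            inj x∈ y∈ eq with preimage x∈ | preimage y∈
            ... | v , v≤ , refl | v' , v'≤ , refl =
              cong ψ (trans (sym (ψ⁻¹-ψ (ℕₚ.m≤n⇒m≤1+n v≤))) (trans eq (ψ⁻¹-ψ (ℕₚ.m≤n⇒m≤1+n v'≤))))

        nface-X-preimage : ∀ {l} → X.NFace (toList σ) r l → ∀ {x} → x ∈ l → ∃ λ v → depthV v ≤ r × x ≡ ψ v
        nface-X-preimage f x∈ = let τ , w , x∈τ = nface-cover f x∈ in proj₂ (withinX⇒T w) x∈τ

        nface-X-inverse : ∀ {l} → X.NFace (toList σ) r l → ∀ {x} → x ∈ l → ψ (ψ⁻¹ x) ≡ x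
        nface-X-inverse f x∈ with nface-X-preimage f x∈
        ... | v , v≤ , refl = cong ψ (ψ⁻¹-ψ (ℕₚ.m≤n⇒m≤1+n v≤))

        nface-T-depth : ∀ {l} → T.NFace rootFacet r l → ∀ {v} → v ∈ l → depthV v ≤ r
        nface-T-depth f v∈ = let τ , w , v∈τ = nface-cover f v∈ in withinT-depth w v∈τ

        nface-X⇒T : ∀ {l} → X.NFace (toList σ) r l → T.NFace rootFacet r (map ψ⁻¹ l)
        nface-X⇒T {l} f@(u , _ , kind) = unique , proj₁ (convert kind) , proj₂ (convert kind)
          where
          inverse = nface-X-inverse f
          unique : Unique (map ψ⁻¹ l)
          unique = unique-map⁺ ψ⁻¹ (λ x∈ y∈ eq → trans (sym (inverse x∈)) (trans (cong ψ eq) (inverse y∈))) u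
          len⁻¹ = length-map ψ⁻¹ l
          Kind : Set
          Kind = (length (map ψ⁻¹ l) < d × Σ (List Vtx) λ τ → T.Within rootFacet r τ × map ψ⁻¹ l ⊆ τ)
               ⊎ (length (map ψ⁻¹ l) ≡ d × T.Within rootFacet r (map ψ⁻¹ l))
               ⊎ (length (map ψ⁻¹ l) ≡ suc d ×
                  (∀ τ → Unique τ → length τ ≡ d → τ ⊆ map ψ⁻¹ l → T.Within rootFacet r τ))
          convert : _ → Face T (map ψ⁻¹ l) × Kind
          convert (inj₁ (len , τ , w , l⊆τ)) with proj₁ (withinX⇒T w)
          ... | w' with within-facet w'
          ... | _ , _ , D , τ⊆ = (D , τ⊆ ∘ Subsetₚ.map⁺ ψ⁻¹ l⊆τ) ,
            inj₁ (subst (_< d) (sym len⁻¹) len , map ψ⁻¹ τ , w' , Subsetₚ.map⁺ ψ⁻¹ l⊆τ)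
          convert (inj₂ (inj₁ (len , w))) with proj₁ (withinX⇒T w)
          ... | w' = proj₂ (proj₂ (within-facet w')) , inj₂ (inj₁ (trans len⁻¹ len , w'))
          convert (inj₂ (inj₂ (len , ws))) = face , inj₂ (inj₂ (trans len⁻¹ len , facets))
            where
            -- The hypothesis concerns facets of `l` in X, so τ is sent there by `ψ` and the
            -- resulting membership is brought back by `ψ⁻¹`.
            facets : ∀ τ → Unique τ → length τ ≡ d → τ ⊆ map ψ⁻¹ l → T.Within rootFacet r τ
            facets τ uτ lenτ τ⊆ = subst (T.Within rootFacet r) (trans (sym (map-∘ τ)) (map-id-local (All.tabulate back)))
              (proj₁ (withinX⇒T (ws (map ψ τ) (unique-map⁺ ψ inj uτ) (trans (length-map ψ τ) lenτ) ψτ⊆)))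
              where
              back : ∀ {v} → v ∈ τ → ψ⁻¹ (ψ v) ≡ v
              back v∈ with ∈-map⁻ ψ⁻¹ (τ⊆ v∈)
              ... | x , x∈ , refl = cong ψ⁻¹ (inverse x∈)
              inj : ∀ {v v'} → v ∈ τ → v' ∈ τ → ψ v ≡ ψ v' → v ≡ v'
              inj v∈ v'∈ eq = trans (sym (back v∈)) (trans (cong ψ⁻¹ eq) (back v'∈))
              ψτ⊆ : map ψ τ ⊆ l
              ψτ⊆ y∈ with ∈-map⁻ ψ y∈
              ... | v , v∈ , refl with ∈-map⁻ ψ⁻¹ (τ⊆ v∈)
              ... | x , x∈ , refl = subst (_∈ l) (sym (inverse x∈)) x∈
            -- One facet of `l` lifts to a tree facet F, and `l` itself to a d-face D at F.
            -- Injectivity up to depth r + 1 then places `ψ⁻¹` of each vertex of `l` in D.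
            face : Face T (map ψ⁻¹ l)
            face with some l len
              where
              some : ∀ l → length l ≡ suc d → ∃ λ x → x ∈ l
              some (x ∷ _) _ = x , here refl
            ... | x , x∈ with facet-through u len x∈
            ... | τ , uτ , lenτ , τ⊆l , _ with withinX-facet (ws τ uτ lenτ τ⊆l)
            ... | F , F≤ , _ , F⊆τ with dface-at F (u , len , proj₁ (proj₂ f)) (τ⊆l ∘ F⊆τ)
            ... | D , _ , refl , D≤ , l⊆D , _ = D , sub
              where
              sub : map ψ⁻¹ l ⊆ toList (dverts D)
              sub v∈ with ∈-map⁻ ψ⁻¹ v∈
              ... | x , x∈ , refl with ∈-map⁻ ψ (l⊆D x∈)
              ... | v , v∈D , refl = subst (_∈ toList (dverts D))
                (sym (ψ⁻¹-ψ (≤-trans (depthV≤depthD D v∈D) (≤-trans D≤ (s≤s F≤))))) v∈D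

        nface-T⇒X : ∀ {l} → T.NFace rootFacet r l → X.NFace (toList σ) r (map ψ l)
        nface-T⇒X {l} f@(u , (D , l⊆) , kind) = ψ-unique D l⊆ u , proj₁ (convert kind) , proj₂ (convert kind)
          where
          inverse : ∀ {v} → v ∈ l → ψ⁻¹ (ψ v) ≡ v
          inverse v∈ = ψ⁻¹-ψ (ℕₚ.m≤n⇒m≤1+n (nface-T-depth f v∈))
          lenψ = length-map ψ l
          Kind : Set
          Kind = (length (map ψ l) < d × Σ (List (Fin n)) λ τ → X.Within (toList σ) r τ × map ψ l ⊆ τ)
               ⊎ (length (map ψ l) ≡ d × X.Within (toList σ) r (map ψ l))
               ⊎ (length (map ψ l) ≡ suc d ×
                  (∀ τ → Unique τ → length τ ≡ d → τ ⊆ map ψ l → X.Within (toList σ) r τ))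
          small : length (map ψ l) ≤ d → Face X (map ψ l)
          small le = inj₁ (≤-trans (card-toSub-≤ (map ψ l)) le)
          convert : _ → Face X (map ψ l) × Kind
          convert (inj₁ (len , τ , w , l⊆τ)) =
            small (subst (_≤ d) (sym lenψ) (ℕₚ.<⇒≤ len)) ,
            inj₁ (subst (_< d) (sym lenψ) len , map ψ τ , withinT⇒X w , Subsetₚ.map⁺ ψ l⊆τ)
          convert (inj₂ (inj₁ (len , w))) =
            small (ℕₚ.≤-reflexive (trans lenψ len)) , inj₂ (inj₁ (trans lenψ len , withinT⇒X w))
          convert (inj₂ (inj₂ (len , ws))) =
            proj₂ (proj₂ (dface-X D u len l⊆)) , inj₂ (inj₂ (trans lenψ len , facets))
            where
            facets : ∀ τ → Unique τ → length τ ≡ d → τ ⊆ map ψ l → X.Within (toList σ) r τ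
            facets τ uτ lenτ τ⊆ = subst (X.Within (toList σ) r) (trans (sym (map-∘ τ)) (map-id-local (All.tabulate back)))
              (withinT⇒X (ws (map ψ⁻¹ τ) (unique-map⁺ ψ⁻¹ inj uτ) (trans (length-map ψ⁻¹ τ) lenτ) ψ⁻¹τ⊆))
              where
              back : ∀ {x} → x ∈ τ → ψ (ψ⁻¹ x) ≡ x
              back x∈ with ∈-map⁻ ψ (τ⊆ x∈)
              ... | v , v∈ , refl = cong ψ (inverse v∈)
              inj : ∀ {x x'} → x ∈ τ → x' ∈ τ → ψ⁻¹ x ≡ ψ⁻¹ x' → x ≡ x'
              inj x∈ x'∈ eq = trans (sym (back x∈)) (trans (cong ψ eq) (back x'∈))
              ψ⁻¹τ⊆ : map ψ⁻¹ τ ⊆ l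
              ψ⁻¹τ⊆ y∈ with ∈-map⁻ ψ⁻¹ y∈
              ... | x , x∈ , refl with ∈-map⁻ ψ (τ⊆ x∈)
              ... | v , v∈ , refl = subst (_∈ l) (sym (inverse v∈)) v∈

        ball-≅ : Nbhd X d (toList σ) r ≅ Nbhd T d rootFacet r
        ball-≅ = ψ⁻¹ , ψ ,
          (λ x f → nface-X⇒T f , nface-X-inverse f (here refl)) ,
          (λ v f → nface-T⇒X f , ψ⁻¹-ψ (ℕₚ.m≤n⇒m≤1+n (nface-T-depth f (here refl)))) ,
          (λ l → nface-X⇒T) , (λ l → nface-T⇒X)

toList-surjective : ∀ (l : List A) → length l ≡ m → ∃ λ (v : Vec A m) → toList v ≡ l
toList-surjective l refl = Vec.fromList l , Vecₚ.toList∘fromList l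

-- `G` is a duplicate-free list of good outcomes, so its length bounds the number of good outcomes
-- from below. For nonempty Ω, the last inequality is |G| / |Ω| ≥ 1 - C / n cleared of denominators.
theorem3p9 : (d k : ℕ) → 1 ≤ d → 1 ≤ k → (r : ℕ) →
    Σ ℕ λ C → 0 < C ×
    ((n : ℕ) → Admissible d n →
    (σ : List (Fin n)) → Unique σ → length σ ≡ d →
    Σ (List (Vec (Fam n) k)) λ G →
    Unique G
    × All (λ t → (t ∈ Ω n d k) × (Nbhd (XCx n d k t) d σ r ≅ Tr d k r)) G
    × (n * length (Ω n d k) ≤ n * length G + C * length (Ω n d k)))
-- The successor makes the constant visibly positive.
theorem3p9 (suc d') (suc k') _ _ r = suc W , s≤s z≤n , bound
  where
  open Exploration d' k'
  W : ℕ
  W = sum (map weight (configs (suc r)))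
  bound : (n : ℕ) → Admissible d n → (σ : List (Fin n)) → Unique σ → length σ ≡ d →
    Σ (List (Vec (Fam n) k)) λ G → Unique G
      × All (λ t → (t ∈ Ω n d k) × (Nbhd (XCx n d k t) d σ r ≅ Tr d k r)) G
      × (n * length (Ω n d k) ≤ n * length G + suc W * length (Ω n d k))
  -- Admissibility gives n ≥ d + 1, hence a vertex to serve as the junk value of `completion`.
  bound zero (() , _)
  bound n@(suc _) _ σ uσ lenσ with toList-surjective σ lenσ
  ... | v , refl = generics (suc r) ,
      Uniqueₚ.filter⁺ (Generic? (suc r)) (Ω-unique n d k) ,
      All.tabulate (λ t∈ → let t∈Ω , generic = ∈-filter⁻ (Generic? (suc r)) t∈ in t∈Ω , local t∈Ω generic) ,
      ≤-trans (generics-abundant (suc r)) (ℕₚ.+-monoʳ-≤ (n * length (generics (suc r))) (ℕₚ.m≤n+m _ (length (Ω n d k))))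
    where
    open Eval zero v uσ
    local : ∀ {t} → t ∈ Ω n d k → Generic (suc r) t → Nbhd (XCx n d k t) d (toList v) r ≅ Tr d k r
    local {t} t∈Ω generic = ball-≅ r λ {a} {b} a≤ b≤ eq →
        embV-injective a b (φ-injective (embV-valid a) (embV-valid b) a≤ b≤ eq)
      where
      open Injectivity {suc r} {t} (∈-Ω⁻ t∈Ω) generic
      open LocalStructure {t} (∈-Ω⁻ t∈Ω)
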